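{- Let $P$ be an integral convex polygon in $\mathbb{R}^2$ with edge sequence $\{n_ie_i\}_{1\le i\le m}$ starting at a vertex $v_0$, with $e_i\in\mathbb{Z}^2$ primitive, and let $IP$ be the set of integral points of $P$. Define integer-valued arrays $c_0,\dots,c_m$ indexed by $IP$ as follows: $c_0(v_0)=1$ and $c_0(v)=0$ for $v\in IP\setminus\{v_0\}$; for $1\le i\le m$ and $w\in IP$, $c_i(w)=\sum_{k} c_{i-1}(w-ke_i)$, the sum over all $0\le k\le n_i$ with $w-ke_i\in IP$. Then $c_m(v_0)$ equals the total number of integral summands of $P$, including the trivial ones.
   Context: An integral polytope is a convex polytope whose vertices have integer coordinates; an integral summand of an integral polytope $P$ is an integral polytope $Q$ such that $P=Q+R$ (Minkowski sum $\{q+r:q\in Q,r\in R\}$) for some integral polytope $R$, summands being counted up to translation; the trivial summands are a single point and $P$ itself. For an integral convex polygon $P$ with vertices $v_0,\dots,v_{m-1}$ in clockwise order, the edge vectors are $E_i=v_i-v_{i-1}\in\mathbb{Z}^2$ (indices mod $m$); writing $E_i=n_ie_i$ with $n_i$ the gcd of the coordinates of $E_i$ and $e_i$ a primitive vector (coprime integer coordinates), $\{n_ie_i\}_{1\le i\le m}$ is the edge sequence of $P$. (In the paper, $c_i(w)$ is the first component of the cell $A_i[w]$ computed by the algorithm PolyDecompNum, and the theorem asserts that the integer it outputs, $c_m(v_0)$, is the number of integral summands.) -}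

module Defs where

open import Data.Nat as ℕ using (ℕ; zero; suc)
open import Data.Nat.GCD using (gcd)
open import Data.Integer as ℤ using (ℤ; +_; ∣_∣)
open import Data.Rational as ℚ using (ℚ; 0ℚ; 1ℚ)
open import Data.List using (List; []; _∷_; map; upTo; length)
open import Data.Fin using (Fin)
open import Data.Product using (Σ; _×_; _,_; ∃; proj₁; proj₂)
open import Relation.Binary.PropositionalEquality using (_≡_; _≢_)
open import Relation.Nullary using (¬_)

ℤ² : Set
ℤ² = ℤ × ℤ

ℚ² : Set
ℚ² = ℚ × ℚ

_-ᶻ_ : ℤ² → ℤ² → ℤ²
(a , b) -ᶻ (c , d) = (a ℤ.- c , b ℤ.- d)

_•_ : ℕ → ℤ² → ℤ²
k • (a , b) = (+ k ℤ.* a , + k ℤ.* b)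

cross : ℤ² → ℤ² → ℤ
cross (a , b) (c , d) = a ℤ.* d ℤ.- b ℤ.* c

toℚ² : ℤ² → ℚ²
toℚ² (a , b) = (a ℚ./ 1 , b ℚ./ 1)

_+ᵠ_ : ℚ² → ℚ² → ℚ²
(a , b) +ᵠ (c , d) = (a ℚ.+ c , b ℚ.+ d)

_-ᵠ_ : ℚ² → ℚ² → ℚ²
(a , b) -ᵠ (c , d) = (a ℚ.- c , b ℚ.- d)

_*ᵠ_ : ℚ → ℚ² → ℚ²
r *ᵠ (a , b) = (r ℚ.* a , r ℚ.* b)

gcd² : ℤ² → ℕ
gcd² (a , b) = gcd ∣ a ∣ ∣ b ∣

AllNonneg : List ℚ → Set
AllNonneg [] = Data.Unit.⊤
  where import Data.Unit
AllNonneg (r ∷ rs) = (0ℚ ℚ.≤ r) × AllNonneg rs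

sumℚ : List ℚ → ℚ
sumℚ [] = 0ℚ
sumℚ (r ∷ rs) = r ℚ.+ sumℚ rs

-- Σ λ_j p_j (extra entries of the longer list are ignored; lengths are required equal below)
combo : List ℚ → List ℤ² → ℚ²
combo (r ∷ rs) (p ∷ ps) = (r *ᵠ toℚ² p) +ᵠ combo rs ps
combo _ _ = (0ℚ , 0ℚ)

-- A (lattice) polytope is given by a finite nonempty list of integer points;
-- it denotes their (real) convex hull.  We test membership of rational points:
-- x ∈ conv(ps) iff x is a convex combination of ps with rational weights.
InHull : List ℤ² → ℚ² → Set
InHull ps x = Σ (List ℚ) λ ls →
  (length ls ≡ length ps) × AllNonneg ls × (sumℚ ls ≡ 1ℚ) × (combo ls ps ≡ x)

InMink : List ℤ² → List ℤ² → ℚ² → Set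
InMink Q R x = Σ ℚ² λ q → Σ ℚ² λ r → InHull Q q × InHull R r × (x ≡ q +ᵠ r)

_⇔_ : Set → Set → Set
A ⇔ B = (A → B) × (B → A)

IsSummand : List ℤ² → List ℤ² → Set
IsSummand P Q = (Q ≢ []) × Σ (List ℤ²) λ R → (R ≢ []) ×
  (∀ (x : ℚ²) → InHull P x ⇔ InMink Q R x)

Translate : List ℤ² → List ℤ² → Set
Translate Q Q' = Σ ℚ² λ t → ∀ (x : ℚ²) → InHull Q' x ⇔ InHull Q (x -ᵠ t)

NumSummands : List ℤ² → ℕ → Set
NumSummands P N = Σ (Fin N → List ℤ²) λ L →
  (∀ j → IsSummand P (L j)) ×
  (∀ j k → Translate (L j) (L k) → j ≡ k) ×
  (∀ Q → IsSummand P Q → ∃ λ j → Translate (L j) Q)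

sumTo : ℕ → (ℕ → ℤ) → ℤ
sumTo zero f = f 0
sumTo (suc n) f = sumTo n f ℤ.+ f (suc n)

Polygon : ℕ → (ℕ → ℤ²) → List ℤ²
Polygon m v = map v (upTo m)

-- Edge vector E_i = v_i - v_{i-1}  (for 1 ≤ i ≤ m)
Edge : (ℕ → ℤ²) → ℕ → ℤ²
Edge v i = v i -ᶻ v (i ℕ.∸ 1)

-- v 0, …, v (m-1) (indices mod m) are the vertices of a convex polygon in clockwise
-- order: every other vertex lies strictly to the right of each directed edge.
ClockwiseConvex : ℕ → (ℕ → ℤ²) → Set
ClockwiseConvex m v = (3 ℕ.≤ m) × (∀ i → v (i ℕ.+ m) ≡ v i) ×
  (∀ i d → i ℕ.< m → 2 ℕ.≤ d → d ℕ.< m →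
     cross (v (suc i) -ᶻ v i) (v (i ℕ.+ d) -ᶻ v i) ℤ.< + 0)

{-# OPTIONS --safe #-}
module Submission where

-- A summand Q of P, with P = Q + R, has at every vertex v_j of P a vertex q_j that supports Q in the directions of
-- both edges of P at v_j; the steps q_{j+1} - q_j are k e_{j+1} with 0 ≤ k ≤ n_{j+1}, so Q is given, up to
-- translation, by a closed walk with such steps.  Conversely, as j runs around P, the height of v_j over a fixed edge
-- line first rises and then falls.  Hence the height of a closed walk is also minimal at the corresponding edge, the
-- heights of a walk and of the complementary walk v - q add up to those of P, and their hulls have Minkowski sum P.
-- In particular the walk stays in P, so that c_m(v_0) counts these walks.  The points q_j span Q by the
-- cancellation law for Minkowski sums, and they are recovered from the support values of Q, so distinct walks give
-- summands that are not translates of each other.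
open import Defs
open import Data.Nat as ℕ using (ℕ; zero; suc; s≤s; z≤n)
import Data.Nat.Properties as ℕₚ
import Data.Nat.DivMod as ℕ
open import Data.Nat.GCD using (GCD; gcd-GCD; module Bézout)
open import Data.Integer as ℤ using (ℤ)
import Data.Integer.Properties as ℤₚ
import Data.Integer.Solver as ℤSolver
open import Data.Rational as ℚ using (ℚ; 0ℚ; 1ℚ; toℚᵘ)
import Data.Rational.Properties as ℚₚ
import Data.Rational.Solver as ℚSolver
import Data.Rational.Unnormalised as ℚᵘ
import Data.Rational.Unnormalised.Properties as ℚᵘₚ
open import Data.Fin using (zero; suc)
open import Data.List using (List; []; _∷_; length; map; _++_; downFrom; lookup)
open import Data.List.Properties using (length-map; length-++; ∷-injectiveʳ; map-cong-local)
open import Data.List.Membership.Propositional using (_∈_)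
open import Data.List.Membership.Propositional.Properties
  using (∈-++⁻; ∈-++⁺ˡ; ∈-++⁺ʳ; ∈-map⁻; ∈-map⁺; ∈-upTo⁻; ∈-upTo⁺; ∈-downFrom⁻; ∈-downFrom⁺; ∈-lookup)
open import Data.List.Relation.Unary.Any as Any using (here; there)
open import Data.List.Relation.Unary.Any.Properties using (lookup-index)
import Data.List.Relation.Unary.All as All
import Data.List.Relation.Unary.AllPairs as AllPairs
open import Data.List.Relation.Unary.Unique.Propositional using (Unique)
import Data.List.Relation.Unary.Unique.Propositional.Properties as Unique
open import Data.Product using (Σ; ∃-syntax; _×_; _,_; proj₁; proj₂)
open import Data.Product.Properties using (≡-dec)
open import Data.Sum using (_⊎_; inj₁; inj₂; [_,_]′)
open import Data.Empty using (⊥; ⊥-elim)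
open import Data.Unit using (tt)
open import Function using (_∘_)
open import Relation.Binary.Definitions using (tri<; tri≈; tri>)
open import Relation.Binary.PropositionalEquality
open import Relation.Nullary using (¬_; yes; no; Dec)
import Relation.Nullary.Decidable as Dec

-- All geometry is over the rationals, with explicit weights and without limits or separation
-- theorems. The half-planes of P are matched with its hull by a triangulation, and the cancellation
-- law is a finite elimination. The height over edge `i` is `det x (D i)` up to a constant. For a
-- clockwise polygon it grows towards the interior, so support always means minimum. Consecutive
-- edges turn strictly, hence a point is determined by its two heights at a vertex. Cancellation
-- enters because the hull of the q_j may be a segment or a point and some steps may vanish: the
-- triangulation, made for a strictly convex polygon, does not apply to it. Integrality enters
-- twice. A decomposition v_j = y + z only provides a rational y, and the lattice point is found
-- among the generators of Q. And since e is primitive, a lattice vector along an edge is an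
-- integral multiple of e.

module RationalPlane where

  open import Data.Rational
  open import Data.Rational.Properties
  open ℚSolver.+-*-Solver

  -- Signs of rational numbers.

  0≤-+ : ∀ {a b} → 0ℚ ≤ a → 0ℚ ≤ b → 0ℚ ≤ a + b
  0≤-+ = +-mono-≤

  0<-+ : ∀ {a b} → 0ℚ < a → 0ℚ ≤ b → 0ℚ < a + b
  0<-+ = +-mono-<-≤

  0≤-* : ∀ {a b} → 0ℚ ≤ a → 0ℚ ≤ b → 0ℚ ≤ a * b
  0≤-* {a} {b} 0≤a 0≤b = nonNegative⁻¹ _ {{nonNeg*nonNeg⇒nonNeg a {{nonNegative 0≤a}} b {{nonNegative 0≤b}}}}

  0<-* : ∀ {a b} → 0ℚ < a → 0ℚ < b → 0ℚ < a * b
  0<-* {a} {b} 0<a 0<b = positive⁻¹ _ {{pos*pos⇒pos a {{positive 0<a}} b {{positive 0<b}}}}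

  0≤⇒≡⊎< : ∀ {a} → 0ℚ ≤ a → a ≡ 0ℚ ⊎ 0ℚ < a
  0≤⇒≡⊎< {a} 0≤a with <-cmp 0ℚ a
  ... | tri< 0<a _ _ = inj₂ 0<a
  ... | tri≈ _ 0≡a _ = inj₁ (sym 0≡a)
  ... | tri> _ _ a<0 = ⊥-elim (<-irrefl refl (≤-<-trans 0≤a a<0))

  0≤-sum-zeroˡ : ∀ {a b} → 0ℚ ≤ a → 0ℚ ≤ b → a + b ≡ 0ℚ → a ≡ 0ℚ
  0≤-sum-zeroˡ {a} {b} 0≤a 0≤b a+b≡0 with 0≤⇒≡⊎< 0≤a
  ... | inj₁ a≡0 = a≡0
  ... | inj₂ 0<a = ⊥-elim (<-irrefl (sym a+b≡0) (0<-+ 0<a 0≤b))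

  0≤-sum-zeroʳ : ∀ {a b} → 0ℚ ≤ a → 0ℚ ≤ b → a + b ≡ 0ℚ → b ≡ 0ℚ
  0≤-sum-zeroʳ {a} {b} 0≤a 0≤b a+b≡0 = 0≤-sum-zeroˡ 0≤b 0≤a (trans (+-comm b a) a+b≡0)

  absent : ∀ a b → 0ℚ * a + b ≡ b
  absent a b = trans (cong (_+ b) (*-zeroˡ a)) (+-identityˡ b)

  -- Convex hulls as cones with a prescribed total weight.

  0ᵠ : ℚ²
  0ᵠ = 0ℚ , 0ℚ

  ℚ²-ext : {x y : ℚ²} → proj₁ x ≡ proj₁ y → proj₂ x ≡ proj₂ y → x ≡ y
  ℚ²-ext = cong₂ _,_

  *ᵠ-zero : ∀ x → 0ℚ *ᵠ x ≡ 0ᵠ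
  *ᵠ-zero (a , b) = ℚ²-ext (*-zeroˡ a) (*-zeroˡ b)

  -- The homogenised convex hull: x = Σ rᵢ pᵢ with rᵢ ≥ 0 and Σ rᵢ = w.
  data Cone : List ℤ² → ℚ → ℚ² → Set where
    []  : Cone [] 0ℚ 0ᵠ
    _∷_ : ∀ {p ps r w x} → 0ℚ ≤ r → Cone ps w x →
          Cone (p ∷ ps) (r + w) ((r *ᵠ toℚ² p) +ᵠ x)

  Hull : List ℤ² → ℚ² → Set
  Hull ps = Cone ps 1ℚ

  InHull⇒Hull : ∀ {ps x} → InHull ps x → Hull ps x
  InHull⇒Hull (ls , len , nonneg , sum≡1 , combo≡x) =
    subst₂ (Cone _) sum≡1 combo≡x (go ls _ len nonneg)
    where
    go : ∀ ls ps → length ls ≡ length ps → AllNonneg ls → Cone ps (sumℚ ls) (combo ls ps)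
    go []       []       _   _          = []
    go (r ∷ rs) (p ∷ ps) len (0≤r , ns) = 0≤r ∷ go rs ps (ℕₚ.suc-injective len) ns

  Hull⇒InHull : ∀ {ps x} → Hull ps x → InHull ps x
  Hull⇒InHull = go
    where
    go : ∀ {ps w x} → Cone ps w x → Σ (List ℚ) λ ls →
         (length ls ≡ length ps) × AllNonneg ls × (sumℚ ls ≡ w) × (combo ls ps ≡ x)
    go [] = [] , refl , tt , refl , refl
    go (_∷_ {p = p} {r = r} 0≤r C) =
      let ls , len , nonneg , sum≡w , combo≡x = go C in
      r ∷ ls , cong suc len , (0≤r , nonneg) , cong (r +_) sum≡w , cong ((r *ᵠ toℚ² p) +ᵠ_) combo≡x

  cone-uncons : ∀ {p ps w x} → Cone (p ∷ ps) w x →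
    ∃[ r ] ∃[ u ] ∃[ y ] (0ℚ ≤ r × Cone ps u y × w ≡ r + u × x ≡ (r *ᵠ toℚ² p) +ᵠ y)
  cone-uncons (0≤r ∷ C) = _ , _ , _ , 0≤r , C , refl , refl

  cone-weight : ∀ {ps w x} → Cone ps w x → 0ℚ ≤ w
  cone-weight []        = ≤-refl
  cone-weight (0≤r ∷ C) = 0≤-+ 0≤r (cone-weight C)

  cone-0 : ∀ ps → Cone ps 0ℚ 0ᵠ
  cone-0 []       = []
  cone-0 (p ∷ ps) = subst (Cone _ _) (cong (_+ᵠ 0ᵠ) (*ᵠ-zero (toℚ² p))) (≤-refl {0ℚ} ∷ cone-0 ps)

  cone-0⁻¹ : ∀ {ps w x} → Cone ps w x → w ≡ 0ℚ → x ≡ 0ᵠ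
  cone-0⁻¹ [] _ = refl
  cone-0⁻¹ (_∷_ {p = p} 0≤r C) r+w≡0
    rewrite 0≤-sum-zeroˡ 0≤r (cone-weight C) r+w≡0
          | cone-0⁻¹ C (0≤-sum-zeroʳ 0≤r (cone-weight C) r+w≡0)
    = cong (_+ᵠ 0ᵠ) (*ᵠ-zero (toℚ² p))

  +-interchange : ∀ r p x s y → (r * p + x) + (s * p + y) ≡ (r + s) * p + (x + y)
  +-interchange = solve 5 (λ r p x s y → (r :* p :+ x) :+ (s :* p :+ y) := (r :+ s) :* p :+ (x :+ y)) refl

  cone-+ : ∀ {ps w u x y} → Cone ps w x → Cone ps u y → Cone ps (w + u) (x +ᵠ y)
  cone-+ [] [] = []
  cone-+ (_∷_ {p = p} {r = r} {w = w} {x = x} 0≤r C) (_∷_ {r = s} {w = u} {x = y} 0≤s C′) =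
    subst₂ (Cone _)
      (solve 4 (λ r s w u → (r :+ s) :+ (w :+ u) := (r :+ w) :+ (s :+ u)) refl r s w u)
      (sym (ℚ²-ext (+-interchange r _ (proj₁ x) s (proj₁ y)) (+-interchange r _ (proj₂ x) s (proj₂ y))))
      (0≤-+ 0≤r 0≤s ∷ cone-+ C C′)

  cone-* : ∀ {ps w x s} → 0ℚ ≤ s → Cone ps w x → Cone ps (s * w) (s *ᵠ x)
  cone-* {s = s} 0≤s [] = subst₂ (Cone []) (sym (*-zeroʳ s)) (sym (ℚ²-ext (*-zeroʳ s) (*-zeroʳ s))) []
  cone-* {s = s} 0≤s (_∷_ {p = p} {r = r} {w = w} {x = x} 0≤r C) =
    subst₂ (Cone _) (sym (*-distribˡ-+ s r w)) (sym (ℚ²-ext (distrib _ _) (distrib _ _)))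
      (0≤-* 0≤s 0≤r ∷ cone-* 0≤s C)
    where
    distrib : ∀ a b → s * (r * a + b) ≡ (s * r) * a + s * b
    distrib = solve 4 (λ s r a b → s :* (r :* a :+ b) := (s :* r) :* a :+ s :* b) refl s r

  -- Allows membership to be certified by unnormalised weights, such as areas or products of
  -- weights; the only division happens here.
  hull-normalise : ∀ {ps w x} → 0ℚ < w → Cone ps w (w *ᵠ x) → Hull ps x
  hull-normalise {w = w} {x} 0<w C =
    subst₂ (Cone _) (*-inverseˡ w) (ℚ²-ext (scale _) (scale _)) (cone-* (<⇒≤ (positive⁻¹ (1/ w) {{1/pos⇒pos w}})) C)
    where
    instance
      pos-w = positive 0<w
      nz-w  = pos⇒nonZero w
    scale : ∀ a → 1/ w * (w * a) ≡ a
    scale a = trans (sym (*-assoc (1/ w) w a)) (trans (cong (_* a) (*-inverseˡ w)) (*-identityˡ a))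

  hull-∈ : ∀ {p ps} → p ∈ ps → Hull ps (toℚ² p)
  hull-∈ {p} {_ ∷ ps} (here refl) =
    subst₂ (Cone _) (+-identityʳ 1ℚ) (ℚ²-ext (unit _) (unit _)) (0≤1 ∷ cone-0 ps)
    where
    0≤1 : 0ℚ ≤ 1ℚ
    0≤1 = nonNegative⁻¹ 1ℚ
    unit : ∀ a → 1ℚ * a + 0ℚ ≡ a
    unit a = trans (+-identityʳ _) (*-identityˡ a)
  hull-∈ {p} {q ∷ ps} (there p∈ps) =
    subst₂ (Cone _) (+-identityˡ 1ℚ) (ℚ²-ext (absent (proj₁ (toℚ² q)) _) (absent (proj₂ (toℚ² q)) _)) (≤-refl
        {0ℚ} ∷ hull-∈ p∈ps)

  -- Each generator is replaced by its combination over `qs` and the weights are multiplied out. The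
  -- translation counts once per unit of weight, hence `w *ᵠ t`.
  cone-translate : ∀ {ps qs w x t} → (∀ {p} → p ∈ ps → Hull qs (toℚ² p +ᵠ t)) →
    Cone ps w x → Cone qs w (x +ᵠ (w *ᵠ t))
  cone-translate {qs = qs} {t = t} f [] =
    subst (Cone qs _) (sym (ℚ²-ext (vanish (proj₁ t)) (vanish (proj₂ t)))) (cone-0 qs)
    where
    vanish : ∀ a → 0ℚ + 0ℚ * a ≡ 0ℚ
    vanish a = trans (+-identityˡ _) (*-zeroˡ a)
  cone-translate {t = t} f (_∷_ {r = r} {w} {x} 0≤r C) =
    subst₂ (Cone _) (cong (_+ w) (*-identityʳ r)) (ℚ²-ext (regroup _ _ _) (regroup _ _ _))
      (cone-+ (cone-* 0≤r (f (here refl))) (cone-translate (f ∘ there) C))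
    where
    regroup : ∀ p t x → r * (p + t) + (x + w * t) ≡ r * p + x + (r + w) * t
    regroup = solve 5 (λ r w p t x → r :* (p :+ t) :+ (x :+ w :* t) := r :* p :+ x :+ (r :+ w) :* t) refl r w

  hull-translate : ∀ {ps qs x t} → (∀ {p} → p ∈ ps → Hull qs (toℚ² p +ᵠ t)) →
    Hull ps x → Hull qs (x +ᵠ t)
  hull-translate {x = x} {t} f C =
    subst (Cone _ _) (cong (x +ᵠ_) (ℚ²-ext (*-identityˡ _) (*-identityˡ _))) (cone-translate f C)

  +ᵠ-identityʳ : ∀ x → x +ᵠ 0ᵠ ≡ x
  +ᵠ-identityʳ x = ℚ²-ext (+-identityʳ _) (+-identityʳ _)

  +ᵠ-comm : ∀ x y → x +ᵠ y ≡ y +ᵠ x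
  +ᵠ-comm x y = ℚ²-ext (+-comm (proj₁ x) (proj₁ y)) (+-comm (proj₂ x) (proj₂ y))

  -- With one summand fixed the other is merely translated, so `hull-translate` applies twice, once
  -- for the generators of each factor.
  hull-minkowski : ∀ {ps qs rs y z} → (∀ {q r} → q ∈ qs → r ∈ rs → Hull ps (toℚ² q +ᵠ toℚ² r)) →
    Hull qs y → Hull rs z → Hull ps (y +ᵠ z)
  hull-minkowski {y = y} {z} f C C′ = subst (Cone _ _) (+ᵠ-comm z y)
    (hull-translate (λ {r} r∈rs → subst (Cone _ _) (+ᵠ-comm y (toℚ² r)) (hull-translate (λ q∈qs → f q∈qs r∈rs) C)) C′)

  -- The weights of the combination serve unchanged for both parts of every generator.
  cone-split : ∀ {ps qs rs w x} →
    (∀ {p} → p ∈ ps → ∃[ y ] ∃[ z ] (Hull qs y × Hull rs z × toℚ² p ≡ y +ᵠ z)) →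
    Cone ps w x → ∃[ y ] ∃[ z ] (Cone qs w y × Cone rs w z × x ≡ y +ᵠ z)
  cone-split f [] = 0ᵠ , 0ᵠ , cone-0 _ , cone-0 _ , refl
  cone-split {ps = p ∷ _} f (_∷_ {r = r} {w} {x} 0≤r C) =
    let y₁ , z₁ , Y₁ , Z₁ , p≡  = f (here refl)
        y₂ , z₂ , Y₂ , Z₂ , x≡ = cone-split (f ∘ there) C
        step : ∀ {ps a b} → Hull ps a → Cone ps w b → Cone ps (r + w) ((r *ᵠ a) +ᵠ b)
        step {a = a} {b} A B = subst (λ s → Cone _ (s + w) ((r *ᵠ a) +ᵠ b)) (*-identityʳ r) (cone-+ (cone-* 0≤r A) B)
    in _ , _ , step Y₁ Y₂ , step Z₁ Z₂ ,
       trans (cong₂ (λ a b → (r *ᵠ a) +ᵠ b) p≡ x≡) (ℚ²-ext (regroup _ _ _ _) (regroup _ _ _ _))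
    where
    regroup : ∀ a b c d → r * (a + b) + (c + d) ≡ (r * a + c) + (r * b + d)
    regroup = solve 5 (λ r a b c d → r :* (a :+ b) :+ (c :+ d) := (r :* a :+ c) :+ (r :* b :+ d)) refl r

  -- Relations α r + β x = z + c with z in the cone over qs and c in the cone over rs.  If there is one for each r in
  -- rs, then the first of them either reads β x = z, or it can be solved for r and substituted in the others.
  Relation : List ℤ² → List ℤ² → ℚ² → ℤ² → Set
  Relation qs rs x r = ∃[ α ] ∃[ β ] ∃[ z ]
    (0ℚ < β × Cone qs β z × Cone rs α (((α *ᵠ toℚ² r) +ᵠ (β *ᵠ x)) -ᵠ z))

  eliminate : ∀ {qs rs x} → rs ≢ [] → (∀ {r} → r ∈ rs → Relation qs rs x r) → Hull qs x
  eliminate {rs = []} rs≢[] _ = ⊥-elim (rs≢[] refl)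
  eliminate {qs} {r ∷ rs} {x} _ rel with rel (here refl)
  ... | α , β , z , 0<β , Z , S with cone-uncons S
  ... | s , u , y , 0≤s , Y , α≡s+u , S≡ with 0≤⇒≡⊎< (cone-weight Y)
  ... | inj₁ u≡0 = hull-normalise 0<β (subst (Cone qs β) (sym (ℚ²-ext (solved (cong proj₁ S≡) (cong proj₁ y≡0))
      (solved (cong proj₂ S≡) (cong proj₂ y≡0)))) Z)
    where
    y≡0 = cone-0⁻¹ Y u≡0
    isolate : ∀ s b z r → (s + 0ℚ) * r + b - z ≡ s * r + 0ℚ → b ≡ z
    isolate s b z r eq = trans (solve 4 (λ s b z r → b := ((s :+ con 0ℚ) :* r :+ b :- z) :+ (z :- s :* r)) refl s b z r)
      (trans (cong (_+ (z - s * r)) eq) (solve 3 (λ s z r → (s :* r :+ con 0ℚ) :+ (z :- s :* r) := z) refl s z r))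
    solved : ∀ {x r z y} → α * r + β * x - z ≡ s * r + y → y ≡ 0ℚ → β * x ≡ z
    solved {x} {r} {z} eq refl = isolate s (β * x) z r (subst (λ a → a * r + β * x - z ≡ s * r + 0ℚ) (trans α≡s+u
        (cong (s +_) u≡0)) eq)
  -- The remaining weight `u` belongs to an empty list and cannot be positive, so the elimination
  -- ends at the last generator at the latest.
  eliminate {qs} {r ∷ []} {x} _ rel | _ | s , u , y , 0≤s , [] , _ | inj₂ 0<u = ⊥-elim (<-irrefl refl 0<u)
  eliminate {qs} {r ∷ rs@(_ ∷ _)} {x} _ rel | α , β , z , 0<β , Z , S | s , u , y , 0≤s , Y , α≡s+u , S≡ | inj₂ 0<u =
    eliminate (λ ()) rel′
    where
    0≤u = <⇒≤ 0<u
    rel′ : ∀ {r′} → r′ ∈ rs → Relation qs rs x r′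
    rel′ {r′} r′∈rs with rel (there r′∈rs)
    ... | α′ , β′ , z′ , 0<β′ , Z′ , S′ with cone-uncons S′
    ... | s′ , u′ , y′ , 0≤s′ , Y′ , α′≡s′+u′ , S′≡ =
      -- This is `u` times the relation of `r′` plus `s′` times that of `r`; the terms in `r` cancel
      -- because `α ≡ s + u`. The coefficient of `x` stays positive since `u` and `β′` are.
      u * α′ , u * β′ + s′ * β , (u *ᵠ z′) +ᵠ (s′ *ᵠ z) ,
      0<-+ (0<-* 0<u 0<β′) (0≤-* 0≤s′ (<⇒≤ 0<β)) ,
      cone-+ (cone-* 0≤u Z′) (cone-* 0≤s′ Z) ,
      subst₂ (Cone rs)
        (trans (solve 3 (λ s′ u u′ → s′ :* u :+ u :* u′ := u :* (s′ :+ u′)) refl s′ u u′) (cong (u *_) (sym α′≡s′+u′)))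
        (sym (ℚ²-ext (combine (cong proj₁ S≡) (cong proj₁ S′≡)) (combine (cong proj₂ S≡) (cong proj₂ S′≡))))
        (cone-+ (cone-* 0≤s′ Y) (cone-* 0≤u Y′))
      where
      combine : ∀ {x r r′ z z′ y y′} → α * r + β * x - z ≡ s * r + y → α′ * r′ + β′ * x - z′ ≡ s′ * r + y′ →
        (u * α′) * r′ + (u * β′ + s′ * β) * x - (u * z′ + s′ * z) ≡ s′ * y + u * y′
      combine {x} {r} {r′} {z} {z′} {y} {y′} eq eq′ = begin
        (u * α′) * r′ + (u * β′ + s′ * β) * x - (u * z′ + s′ * z)
          ≡⟨ solve 11 (λ u α′ r′ β′ s′ β x z z′ α r →
               (u :* α′) :* r′ :+ (u :* β′ :+ s′ :* β) :* x :- (u :* z′ :+ s′ :* z)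
               := u :* (α′ :* r′ :+ β′ :* x :- z′) :+ (s′ :* (α :* r :+ β :* x :- z) :- s′ :* (α :* r)))
               refl u α′ r′ β′ s′ β x z z′ α r ⟩
        u * (α′ * r′ + β′ * x - z′) + (s′ * (α * r + β * x - z) - s′ * (α * r))
          ≡⟨ cong₂ (λ a b → u * a + (s′ * b - s′ * (α * r))) eq′ eq ⟩
        u * (s′ * r + y′) + (s′ * (s * r + y) - s′ * (α * r))
          ≡⟨ cong (λ a → u * (s′ * r + y′) + (s′ * (s * r + y) - s′ * (a * r))) α≡s+u ⟩
        u * (s′ * r + y′) + (s′ * (s * r + y) - s′ * ((s + u) * r))
          ≡⟨ solve 6 (λ u s′ r y′ s y → u :* (s′ :* r :+ y′) :+ (s′ :* (s :* r :+ y) :- s′ :*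
              ((s :+ u) :* r)) := s′ :* y :+ u :* y′) refl u s′ r y′ s y ⟩
        s′ * y + u * y′ ∎
        where open ≡-Reasoning

  -- The usual argument iterates `r + x ≡ y + z` and passes to a limit, for which the hull must be
  -- closed. Here the weights of the points `z` define a finite Markov chain on `rs`; combining the
  -- equations with a stationary distribution cancels all of `rs`. `eliminate` reaches such a
  -- combination by removing one generator after another.
  minkowski-cancel : ∀ {qs rs x} → rs ≢ [] →
    (∀ {r} → r ∈ rs → ∃[ y ] ∃[ z ] (Hull qs y × Hull rs z × toℚ² r +ᵠ x ≡ y +ᵠ z)) → Hull qs x
  minkowski-cancel {x = x} rs≢[] f = eliminate rs≢[] λ {r} r∈rs →
    let y , z , Y , Z , eq = f r∈rs in
    1ℚ , 1ℚ , y , positive⁻¹ 1ℚ , Y ,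
    subst (Cone _ _) (sym (ℚ²-ext (move (proj₁ (toℚ² r)) (proj₁ x) (cong proj₁ eq)) (move (proj₂ (toℚ² r)) (proj₂ x)
        (cong proj₂ eq)))) Z
    where
    move : ∀ r x {y z} → r + x ≡ y + z → 1ℚ * r + 1ℚ * x - y ≡ z
    move r x {y} {z} eq = trans (cong₂ (λ a b → a + b - y) (*-identityˡ r) (*-identityˡ x))
      (trans (cong (_- y) eq) (solve 2 (λ y z → y :+ z :- y := z) refl y z))

  -- Determinants as linear functionals on the plane.

  det : ℚ² → ℚ² → ℚ
  det (a , b) (c , d) = a * d - b * c

  infix 9 _⊗_
  infix 10 _⊖_
  _⊗_ : ∀ {n} → Polynomial n × Polynomial n → Polynomial n × Polynomial n → Polynomial n
  (a , b) ⊗ (c , d) = a :* d :- b :* c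

  _⊖_ : ∀ {n} → Polynomial n × Polynomial n → Polynomial n × Polynomial n → Polynomial n × Polynomial n
  (a , b) ⊖ (c , d) = (a :- c) , (b :- d)

  cramer : ∀ w u z → det w u *ᵠ z ≡ (det w z *ᵠ u) +ᵠ (det z u *ᵠ w)
  cramer (w₁ , w₂) (u₁ , u₂) (z₁ , z₂) = ℚ²-ext
    (solve 6 (λ w₁ w₂ u₁ u₂ z₁ z₂ → let w = w₁ , w₂ ; u = u₁ , u₂ ; z = z₁ , z₂ in
      w ⊗ u :* z₁ := w ⊗ z :* u₁ :+ z ⊗ u :* w₁) refl w₁ w₂ u₁ u₂ z₁ z₂)
    (solve 6 (λ w₁ w₂ u₁ u₂ z₁ z₂ → let w = w₁ , w₂ ; u = u₁ , u₂ ; z = z₁ , z₂ in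
      w ⊗ u :* z₂ := w ⊗ z :* u₂ :+ z ⊗ u :* w₂) refl w₁ w₂ u₁ u₂ z₁ z₂)

  det-linear : ∀ a b u w d → det ((a *ᵠ u) +ᵠ (b *ᵠ w)) d ≡ a * det u d + b * det w d
  det-linear a b (u₁ , u₂) (w₁ , w₂) (d₁ , d₂) =
    solve 8 (λ a b u₁ u₂ w₁ w₂ d₁ d₂ →
      (a :* u₁ :+ b :* w₁ , a :* u₂ :+ b :* w₂) ⊗ (d₁ , d₂) := a :* (u₁ , u₂) ⊗ (d₁ , d₂) :+ b :* (w₁ , w₂) ⊗ (d₁ , d₂))
      refl a b u₁ u₂ w₁ w₂ d₁ d₂

  det-scale : ∀ a u d → det (a *ᵠ u) d ≡ a * det u d
  det-scale a (u₁ , u₂) (d₁ , d₂) =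
    solve 5 (λ a u₁ u₂ d₁ d₂ → (a :* u₁ , a :* u₂) ⊗ (d₁ , d₂) := a :* (u₁ , u₂) ⊗ (d₁ , d₂)) refl a u₁ u₂ d₁ d₂

  det-add : ∀ u w d → det (u +ᵠ w) d ≡ det u d + det w d
  det-add (u₁ , u₂) (w₁ , w₂) (d₁ , d₂) =
    solve 6 (λ u₁ u₂ w₁ w₂ d₁ d₂ → (u₁ :+ w₁ , u₂ :+ w₂) ⊗ (d₁ , d₂) := (u₁ , u₂) ⊗ (d₁ , d₂) :+ (w₁ , w₂) ⊗ (d₁ , d₂))
      refl u₁ u₂ w₁ w₂ d₁ d₂

  det-sub : ∀ u w d → det (u -ᵠ w) d ≡ det u d - det w d
  det-sub (u₁ , u₂) (w₁ , w₂) (d₁ , d₂) =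
    solve 6 (λ u₁ u₂ w₁ w₂ d₁ d₂ → ((u₁ , u₂) ⊖ (w₁ , w₂)) ⊗ (d₁ , d₂) := (u₁ , u₂) ⊗ (d₁ , d₂) :- (w₁ , w₂) ⊗ (d₁ , d₂))
      refl u₁ u₂ w₁ w₂ d₁ d₂

  det-anti : ∀ u w → det u w ≡ - det w u
  det-anti (u₁ , u₂) (w₁ , w₂) = solve 4 (λ u₁ u₂ w₁ w₂ → (u₁ , u₂) ⊗ (w₁ , w₂) := :- ((w₁ , w₂) ⊗ (u₁ , u₂)))
      refl u₁ u₂ w₁ w₂

  det-self : ∀ u → det u u ≡ 0ℚ
  det-self (u₁ , u₂) = solve 2 (λ u₁ u₂ → (u₁ , u₂) ⊗ (u₁ , u₂) := con 0ℚ) refl u₁ u₂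

  det-shear : ∀ a b c → det (a -ᵠ c) (b -ᵠ c) ≡ det (a -ᵠ b) (b -ᵠ c)
  det-shear (a₁ , a₂) (b₁ , b₂) (c₁ , c₂) =
    solve 6 (λ a₁ a₂ b₁ b₂ c₁ c₂ → let a = a₁ , a₂ ; b = b₁ , b₂ ; c = c₁ , c₂ in
      (a ⊖ c) ⊗ (b ⊖ c) := (a ⊖ b) ⊗ (b ⊖ c)) refl a₁ a₂ b₁ b₂ c₁ c₂

  det-difference : ∀ {u w d} → det u d ≡ det w d → det (u -ᵠ w) d ≡ 0ℚ
  det-difference {u} {w} {d} eq = trans (det-sub u w d) (trans (cong (_- det w d) eq) (+-inverseʳ (det w d)))

  *-cancel-0 : ∀ {a b} → 0ℚ < a → a * b ≡ 0ℚ → b ≡ 0ℚ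
  *-cancel-0 {a} {b} 0<a ab≡0 = ≤-antisym
    (*-cancelˡ-≤-pos a (≤-reflexive (trans ab≡0 (sym (*-zeroʳ a)))))
    (*-cancelˡ-≤-pos a (≤-reflexive (trans (*-zeroʳ a) (sym ab≡0))))
    where instance a-positive = positive 0<a

  det-nondegenerate : ∀ {w u z} → 0ℚ < det w u → det z w ≡ 0ℚ → det z u ≡ 0ℚ → z ≡ 0ᵠ
  det-nondegenerate {w} {u} {z} 0<wu zw≡0 zu≡0 = ℚ²-ext (vanish (proj₁ z) (proj₁ u) (proj₁ w) (cong proj₁ eq))
      (vanish (proj₂ z) (proj₂ u) (proj₂ w) (cong proj₂ eq))
    where
    wz≡0 : det w z ≡ 0ℚ
    wz≡0 = trans (det-anti w z) (cong -_ zw≡0)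
    eq : det w u *ᵠ z ≡ (0ℚ *ᵠ u) +ᵠ (0ℚ *ᵠ w)
    eq = trans (cramer w u z) (cong₂ (λ a b → (a *ᵠ u) +ᵠ (b *ᵠ w)) wz≡0 zu≡0)
    vanish : ∀ z′ u′ w′ → det w u * z′ ≡ 0ℚ * u′ + 0ℚ * w′ → z′ ≡ 0ℚ
    vanish z′ u′ w′ e = *-cancel-0 0<wu (trans e (cong₂ _+_ (*-zeroˡ u′) (*-zeroˡ w′)))

  0≤-diff : ∀ {a b} → 0ℚ ≤ b - a → a ≤ b
  0≤-diff {a} {b} 0≤b-a = subst₂ _≤_ (+-identityˡ a) (solve 2 (λ a b → b :- a :+ a := b) refl a b) (+-monoˡ-≤ a 0≤b-a)

  ≤-diff : ∀ {a b} → a ≤ b → 0ℚ ≤ b - a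
  ≤-diff {a} {b} a≤b = subst (_≤ b - a) (+-inverseʳ a) (+-monoˡ-≤ (- a) a≤b)

  cone-bound : ∀ {ps w x d c} → (∀ {p} → p ∈ ps → c ≤ det (toℚ² p) d) → Cone ps w x → w * c ≤ det x d
  cone-bound {d = d@(d₁ , d₂)} {c} f [] =
    ≤-reflexive (solve 3 (λ c d₁ d₂ → con 0ℚ :* c := (con 0ℚ , con 0ℚ) ⊗ (d₁ , d₂)) refl c d₁ d₂)
  cone-bound {d = d@(d₁ , d₂)} {c} f (_∷_ {p = p} {r = r} {w} {x} 0≤r C) = subst₂ _≤_
    (sym (*-distribʳ-+ c r w))
    (sym (trans (det-add (r *ᵠ toℚ² p) x d) (cong (_+ det x d) (det-scale r (toℚ² p) d))))
    (+-mono-≤ (*-monoˡ-≤-nonNeg r {{nonNegative 0≤r}} (f (here refl))) (cone-bound (f ∘ there) C))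

  hull-bound : ∀ {ps x d c} → (∀ {p} → p ∈ ps → c ≤ det (toℚ² p) d) → Hull ps x → c ≤ det x d
  hull-bound {c = c} f C = subst (_≤ _) (*-identityˡ c) (cone-bound f C)

  -- A discrete intermediate value theorem. The bounds on `j` are kept because `fan` needs a
  -- nondegenerate triangle.
  sign-change : (f : ℕ → ℚ) → ∀ k i → 0ℚ ≤ f i → f (suc (k ℕ.+ i)) ≤ 0ℚ →
    ∃[ j ] (i ℕ.≤ j × j ℕ.≤ k ℕ.+ i × 0ℚ ≤ f j × f (suc j) ≤ 0ℚ)
  sign-change f zero i 0≤ ≤0 = i , ℕₚ.≤-refl , ℕₚ.≤-refl , 0≤ , ≤0
  sign-change f (suc k) i 0≤ ≤0 with ≤-total (f (suc i)) 0ℚ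
  ... | inj₁ fsi≤0 = i , ℕₚ.≤-refl , ℕₚ.m≤n+m i (suc k) , 0≤ , fsi≤0
  ... | inj₂ 0≤fsi with sign-change f k (suc i) 0≤fsi (subst (λ n → f (suc n) ≤ 0ℚ) (sym (ℕₚ.+-suc k i)) ≤0)
  ...   | j , i<j , j≤ , 0≤fj , fsj≤0 = j , ℕₚ.<⇒≤ i<j , subst (j ℕ.≤_) (ℕₚ.+-suc k i) j≤ , 0≤fj , fsj≤0

  -- Support and triangulation of a convex polygon.

  module ConvexPolygon (m′ : ℕ) (V : ℕ → ℚ²) (3≤m : 3 ℕ.≤ suc m′)
    (periodic : ∀ i → V (suc m′ ℕ.+ i) ≡ V i)
    (convex : ∀ i d → 2 ℕ.≤ d → d ℕ.< suc m′ → 0ℚ < det (V (d ℕ.+ i) -ᵠ V i) (V (suc i) -ᵠ V i))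
    where

    m : ℕ
    m = suc m′

    D : ℕ → ℚ²
    D i = V (suc i) -ᵠ V i

    D-periodic : ∀ i → D (m ℕ.+ i) ≡ D i
    D-periodic i = cong₂ _-ᵠ_ (trans (cong (V ∘ suc) (sym (ℕₚ.+-suc m′ i))) (periodic (suc i))) (periodic i)

    turn : ∀ i → 0ℚ < det (D (suc i)) (D i)
    turn i = subst (0ℚ <_) (det-shear (V (suc (suc i))) (V (suc i)) (V i)) (convex i 2 ℕₚ.≤-refl 3≤m)

    -- `convex` looks forward from an edge. The vertex `V i` lies behind edge `k + i`, and is
    -- reached by completing the round.
    right-of : ∀ i k d → d ℕ.+ k ≡ m → 2 ℕ.≤ d → d ℕ.< m → 0ℚ < det (V i -ᵠ V (k ℕ.+ i)) (D (k ℕ.+ i))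
    right-of i k d d+k≡m 2≤d d<m =
      subst (λ x → 0ℚ < det (x -ᵠ V (k ℕ.+ i)) (D (k ℕ.+ i)))
        (trans (cong V (trans (sym (ℕₚ.+-assoc d k i)) (cong (ℕ._+ i) d+k≡m))) (periodic i))
        (convex (k ℕ.+ i) d 2≤d d<m)

    -- Measure depth from the line of edge i into P.  If the depth were non-increasing into p = V (i+d+1) and increasing
    -- out of it, then V i, which is less deep, would lie outside the corner of P at p.
    unimodal : ∀ i d → 1 ℕ.≤ d → suc d ℕ.< m → det (D (d ℕ.+ i)) (D i) ≤ 0ℚ → det (D (suc d ℕ.+ i)) (D i) ≤ 0ℚ
    unimodal i d 1≤d 1+d<m uD≤0 with det (D (suc d ℕ.+ i)) (D i) ≤? 0ℚ
    ... | yes wD≤0 = wD≤0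
    ... | no  wD≰0 = ⊥-elim contra
      where
      p = V (suc d ℕ.+ i)
      u = D (d ℕ.+ i)
      w = D (suc d ℕ.+ i)
      z = V i -ᵠ p
      0<wD : 0ℚ < det w (D i)
      0<wD = ≰⇒> wD≰0
      0<-zD : 0ℚ < - det z (D i)
      0<-zD = subst (0ℚ <_) (flip p (V i) (D i)) (convex i (suc d) (s≤s 1≤d) 1+d<m)
        where
        flip : ∀ p q e → det (p -ᵠ q) e ≡ - det (q -ᵠ p) e
        flip (p₁ , p₂) (q₁ , q₂) (e₁ , e₂) = solve 6 (λ p₁ p₂ q₁ q₂ e₁ e₂ → let p = p₁ , p₂ ; q = q₁ , q₂ ; e = e₁ , e₂ in
          (p ⊖ q) ⊗ e := :- ((q ⊖ p) ⊗ e)) refl p₁ p₂ q₁ q₂ e₁ e₂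
      contra : ⊥
      contra with ℕₚ.m≤n⇒m<n∨m≡n 1+d<m
      -- The edge out of `p` ends at `V i`, so `z` coincides with `w`, and `0<wD` contradicts
      -- `0<-zD`.
      ... | inj₂ refl = <-irrefl refl (subst (0ℚ <_) (+-inverseʳ (det w (D i))) (0<-+ 0<wD (<⇒≤ (subst
          (λ x → 0ℚ < - det x (D i)) (cong (_-ᵠ p) (sym (periodic i))) 0<-zD))))
      ... | inj₁ 2+d<m = <-irrefl refl (subst (0ℚ <_) sum≡0 (0<-+ (0<-* 0<wu 0<-zD) (0≤-+ (0≤-* (<⇒≤ 0<zw)
          (neg-antimono-≤ uD≤0)) (0≤-* (<⇒≤ 0<zu) (<⇒≤ 0<wD)))))
        where
        0<wu : 0ℚ < det w u
        0<wu = turn (d ℕ.+ i)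
        0<zw : 0ℚ < det z w
        0<zw = right-of i (suc d) (m ℕ.∸ suc d) (ℕₚ.m∸n+n≡m (ℕₚ.<⇒≤ 1+d<m)) (ℕₚ.m+n≤o⇒m≤o∸n 2 2+d<m) (ℕₚ.∸-monoʳ-<
            {m} {suc d} {0} (s≤s z≤n) (ℕₚ.<⇒≤ 1+d<m))
        0<zu : 0ℚ < det z u
        0<zu = subst (0ℚ <_) (det-shear (V i) p (V (d ℕ.+ i)))
          (right-of i d (m ℕ.∸ d) (ℕₚ.m∸n+n≡m (ℕₚ.<⇒≤ (ℕₚ.<-trans (ℕₚ.n<1+n d) 1+d<m))) (ℕₚ.m+n≤o⇒m≤o∸n 2 1+d<m)
              (ℕₚ.∸-monoʳ-< {m} {d} {0} 1≤d (ℕₚ.<⇒≤ (ℕₚ.<-trans (ℕₚ.n<1+n d) 1+d<m))))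
        -- This is the height functional `det _ (D i)` applied to the linear relation `cramer`
        -- between `w`, `u` and `z`. All signs are known, and the first term is positive.
        sum≡0 : det w u * - det z (D i) + (det z w * - det u (D i) + det z u * det w (D i)) ≡ 0ℚ
        sum≡0 = begin
          det w u * - det z (D i) + (det z w * - det u (D i) + det z u * det w (D i))
            ≡⟨ solve 6 (λ wu zD zw uD zu wD → wu :* :- zD :+ (zw :* :- uD :+ zu :* wD) :=
                (:- zw :* uD :+ zu :* wD) :- wu :* zD)
                 refl (det w u) (det z (D i)) (det z w) (det u (D i)) (det z u) (det w (D i)) ⟩
          (- det z w * det u (D i) + det z u * det w (D i)) - det w u * det z (D i)
            ≡⟨ cong₂ _-_ (trans (cong (λ a → a * det u (D i) + det z u * det w (D i)) (sym (det-anti w z))) (sym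
                (det-linear (det w z) (det z u) u w (D i)))) (sym (det-scale (det w u) z (D i))) ⟩
          det ((det w z *ᵠ u) +ᵠ (det z u *ᵠ w)) (D i) - det (det w u *ᵠ z) (D i)
            ≡⟨ cong (λ x → det x (D i) - det (det w u *ᵠ z) (D i)) (sym (cramer w u z)) ⟩
          det (det w u *ᵠ z) (D i) - det (det w u *ᵠ z) (D i)
            ≡⟨ +-inverseʳ (det (det w u *ᵠ z) (D i)) ⟩
          0ℚ ∎
          where open ≡-Reasoning

    -- The coefficients are arbitrary nonnegative rationals, so one support theorem covers both P
    -- itself and every lattice chain.
    record Circuit (q : ℕ → ℚ²) : Set where
      field
        closed : ∀ i → q (m ℕ.+ i) ≡ q i
        edge   : ∀ i → ∃[ t ] (0ℚ ≤ t × q (suc i) ≡ q i +ᵠ (t *ᵠ D i))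

    module _ {q : ℕ → ℚ²} (Q : Circuit q) where
      open Circuit Q

      private
        module _ (i : ℕ) where
          g : ℕ → ℚ
          g d = det (q (d ℕ.+ i)) (D i)

          g-step : ∀ d → let t = proj₁ (edge (d ℕ.+ i)) in g (suc d) ≡ g d + t * det (D (d ℕ.+ i)) (D i)
          g-step d = let t , _ , eq = edge (d ℕ.+ i) in
            trans (cong (λ x → det x (D i)) eq) (trans (det-add (q (d ℕ.+ i)) (t *ᵠ D (d ℕ.+ i)) (D i)) (cong
                (g d +_) (det-scale t (D (d ℕ.+ i)) (D i))))

          g-up : ∀ d → 0ℚ ≤ det (D (d ℕ.+ i)) (D i) → g d ≤ g (suc d)
          g-up d 0≤ = subst₂ _≤_ (+-identityʳ (g d)) (sym (g-step d)) (+-monoʳ-≤ (g d) (0≤-* (proj₁ (proj₂ (edge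
              (d ℕ.+ i)))) 0≤))

          g-down : ∀ d → det (D (d ℕ.+ i)) (D i) ≤ 0ℚ → g (suc d) ≤ g d
          g-down d ≤0 = subst₂ _≤_ (sym (g-step d)) (+-identityʳ (g d)) (+-monoʳ-≤ (g d)
            (subst (t * det (D (d ℕ.+ i)) (D i) ≤_) (*-zeroʳ t) (*-monoˡ-≤-nonNeg t {{nonNegative (proj₁ (proj₂
                (edge (d ℕ.+ i))))}} ≤0)))
            where t = proj₁ (edge (d ℕ.+ i))

          -- `unimodal` carries a descent along edge `d` over to all later edges of the round, so
          -- the closing value `g m`, which is again `g 0`, lies below `g (suc d)`.
          tail : ∀ k d → 1 ℕ.≤ d → k ℕ.+ suc d ≡ m → det (D (d ℕ.+ i)) (D i) ≤ 0ℚ → g m ≤ g (suc d)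
          tail zero d _ refl _ = ≤-refl
          tail (suc k) d 1≤d eq ≤0 =
            ≤-trans (tail k (suc d) (s≤s z≤n) (trans (ℕₚ.+-suc k (suc d)) eq) next) (g-down (suc d) next)
            where
            next = unimodal i d 1≤d (subst (suc (suc d) ℕ.≤_) eq (s≤s (ℕₚ.m≤n+m (suc d) k))) ≤0

          g-min : ∀ d → d ℕ.≤ m → g 0 ≤ g d
          g-min zero _ = ≤-refl
          g-min (suc zero) _ = g-up 0 (≤-reflexive (sym (det-self (D i))))
          g-min (suc (suc d)) d<m =
            [ (λ ≤0 → subst (_≤ g (suc (suc d))) (cong (λ x → det x (D i)) (closed i))
                        (tail (m ℕ.∸ suc (suc d)) (suc d) (s≤s z≤n) (ℕₚ.m∸n+n≡m d<m) ≤0))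
            , (λ 0≤ → ≤-trans (g-min (suc d) (ℕₚ.<⇒≤ d<m)) (g-up (suc d) 0≤))
            ]′ (≤-total (det (D (suc d ℕ.+ i)) (D i)) 0ℚ)

      circuit-support : ∀ i j → i ℕ.≤ m → j ℕ.≤ m → det (q i) (D i) ≤ det (q j) (D i)
      circuit-support i j i≤m j≤m with i ℕ.≤? j
      ... | yes i≤j = subst (λ k → det (q i) (D i) ≤ det (q k) (D i)) (ℕₚ.m∸n+n≡m i≤j)
                        (g-min i (j ℕ.∸ i) (ℕₚ.≤-trans (ℕₚ.m∸n≤m j i) j≤m))
      -- The vertex `j` comes before `i`, so it is reached in the next round as `m + j`.
      ... | no  i≰j = subst (λ x → det (q i) (D i) ≤ det x (D i)) (trans (cong q (ℕₚ.m∸n+n≡m i≤m+j)) (closed j))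
                        (g-min i (m ℕ.+ j ℕ.∸ i) (ℕₚ.m≤n+o⇒m∸n≤o (m ℕ.+ j) i (subst (ℕ._≤ i ℕ.+ m) (ℕₚ.+-comm j m)
                            (ℕₚ.+-monoˡ-≤ m (ℕₚ.<⇒≤ (ℕₚ.≰⇒> i≰j))))))
        where
        i≤m+j = ℕₚ.≤-trans i≤m (ℕₚ.m≤m+n m j)

    boundary : Circuit V
    boundary = record
      { closed = periodic
      ; edge   = λ i → 1ℚ , nonNegative⁻¹ 1ℚ , ℚ²-ext (split (proj₁ (V (suc i))) (proj₁ (V i))) (split (proj₂ (V
          (suc i))) (proj₂ (V i)))
      }
      where
      split : ∀ a b → a ≡ b + 1ℚ * (a - b)
      split = solve 2 (λ a b → a := b :+ con 1ℚ :* (a :- b)) refl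

    record InFan (x : ℚ²) : Set where
      field
        index             : ℕ
        a b c             : ℚ
        0≤a               : 0ℚ ≤ a
        0≤b               : 0ℚ ≤ b
        0≤c               : 0ℚ ≤ c
        0<total           : 0ℚ < a + (b + c)
        barycentric       : (a + (b + c)) *ᵠ x ≡ (a *ᵠ V 0) +ᵠ ((b *ᵠ V index) +ᵠ (c *ᵠ V (suc index)))

    -- The diagonals from `V 0` cut P into triangles. The sign of `s j` tells on which side of the
    -- ray from `V 0` to `V j` the point lies, and a change of sign locates its triangle. The
    -- weights are the doubled areas of the triangles spanned by `x` and one side of the located
    -- triangle, each belonging to the opposite corner.
    fan : ∀ x → (∀ i → i ℕ.< m → det (V i) (D i) ≤ det x (D i)) → InFan x
    fan x inside = record
      { index = i
      ; a = det (x -ᵠ V i) (D i) ; b = - s (suc i) ; c = s i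
      ; 0≤a = above i (ℕₚ.<⇒≤ 1+i<m) ; 0≤b = neg-antimono-≤ ssi≤0 ; 0≤c = 0≤si
      ; 0<total = subst (0ℚ <_) (sym total≡) 0<total
      ; barycentric = trans (cong (_*ᵠ x) total≡) (barycentre x (V 0) (V i) (V (suc i)))
      }
      where
      s : ℕ → ℚ
      s j = det (x -ᵠ V 0) (V j -ᵠ V 0)
      above : ∀ j → j ℕ.< m → 0ℚ ≤ det (x -ᵠ V j) (D j)
      above j j<m = subst (0ℚ ≤_) (sym (det-sub x (V j) (D j))) (≤-diff (inside j j<m))
      last : s m′ ≤ 0ℚ
      last = subst (_≤ 0ℚ) (trans (cong (λ o → - det (x -ᵠ V m′) (o -ᵠ V m′)) (trans (cong (V ∘ suc) (sym
          (ℕₚ.+-identityʳ m′))) (periodic 0))) (swap x (V m′) (V 0)))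
               (neg-antimono-≤ (above m′ ℕₚ.≤-refl))
        where
        swap : ∀ x v o → - det (x -ᵠ v) (o -ᵠ v) ≡ det (x -ᵠ o) (v -ᵠ o)
        swap (x₁ , x₂) (v₁ , v₂) (o₁ , o₂) =
          solve 6 (λ x₁ x₂ v₁ v₂ o₁ o₂ → let x = x₁ , x₂ ; v = v₁ , v₂ ; o = o₁ , o₂ in
            :- ((x ⊖ v) ⊗ (o ⊖ v)) := (x ⊖ o) ⊗ (v ⊖ o)) refl x₁ x₂ v₁ v₂ o₁ o₂
      -- The search runs from the ray to `V 1` up to the ray to `V m′`; one unit is taken by the
      -- start at 1, the other by the successor in `sign-change`.
      k = m′ ℕ.∸ 2
      k≡ : suc (k ℕ.+ 1) ≡ m′
      k≡ = trans (sym (ℕₚ.+-suc k 1)) (ℕₚ.m∸n+n≡m (ℕ.s≤s⁻¹ 3≤m))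
      change = sign-change s k 1 (above 0 (s≤s z≤n)) (subst (λ n → s n ≤ 0ℚ) (sym k≡) last)
      i = proj₁ change
      1≤i = proj₁ (proj₂ change)
      1+i<m : suc i ℕ.< m
      1+i<m = s≤s (subst (suc i ℕ.≤_) k≡ (s≤s (proj₁ (proj₂ (proj₂ change)))))
      0≤si = proj₁ (proj₂ (proj₂ (proj₂ change)))
      ssi≤0 = proj₂ (proj₂ (proj₂ (proj₂ change)))
      0<total : 0ℚ < det (V 0 -ᵠ V i) (V (suc i) -ᵠ V i)
      0<total = subst (λ n → 0ℚ < det (V 0 -ᵠ V n) (D n)) (ℕₚ.+-identityʳ i)
        (right-of 0 i (m ℕ.∸ i) (ℕₚ.m∸n+n≡m (ℕₚ.<⇒≤ (ℕₚ.<⇒≤ 1+i<m))) (ℕₚ.m+n≤o⇒m≤o∸n 2 1+i<m) (ℕₚ.∸-monoʳ-< {m} {i}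
            {0} 1≤i (ℕₚ.<⇒≤ (ℕₚ.<⇒≤ 1+i<m))))
      total≡ : det (x -ᵠ V i) (D i) + (- s (suc i) + s i) ≡ det (V 0 -ᵠ V i) (D i)
      total≡ = area x (V 0) (V i) (V (suc i))
        where
        area : ∀ x o v w → det (x -ᵠ v) (w -ᵠ v) + (- det (x -ᵠ o) (w -ᵠ o) + det (x -ᵠ o) (v -ᵠ o)) ≡ det (o -ᵠ v)
            (w -ᵠ v)
        area (x₁ , x₂) (o₁ , o₂) (v₁ , v₂) (w₁ , w₂) =
          solve 8 (λ x₁ x₂ o₁ o₂ v₁ v₂ w₁ w₂ → let x = x₁ , x₂ ; o = o₁ , o₂ ; v = v₁ , v₂ ; w = w₁ , w₂ in
            (x ⊖ v) ⊗ (w ⊖ v) :+ (:- ((x ⊖ o) ⊗ (w ⊖ o)) :+ (x ⊖ o) ⊗ (v ⊖ o)) := (o ⊖ v) ⊗ (w ⊖ v))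
                refl x₁ x₂ o₁ o₂ v₁ v₂ w₁ w₂
      barycentre : ∀ x o v w → det (o -ᵠ v) (w -ᵠ v) *ᵠ x ≡
        (det (x -ᵠ v) (w -ᵠ v) *ᵠ o) +ᵠ (((- det (x -ᵠ o) (w -ᵠ o)) *ᵠ v) +ᵠ (det (x -ᵠ o) (v -ᵠ o) *ᵠ w))
      barycentre (x₁ , x₂) (o₁ , o₂) (v₁ , v₂) (w₁ , w₂) = ℚ²-ext
        (solve 8 (λ x₁ x₂ o₁ o₂ v₁ v₂ w₁ w₂ → let x = x₁ , x₂ ; o = o₁ , o₂ ; v = v₁ , v₂ ; w = w₁ , w₂ in
            (o ⊖ v) ⊗ (w ⊖ v) :* x₁ := (x ⊖ v) ⊗ (w ⊖ v) :* o₁ :+ (:- ((x ⊖ o) ⊗ (w ⊖ o)) :* v₁ :+ (x ⊖ o) ⊗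
                (v ⊖ o) :* w₁)) refl x₁ x₂ o₁ o₂ v₁ v₂ w₁ w₂)
        (solve 8 (λ x₁ x₂ o₁ o₂ v₁ v₂ w₁ w₂ → let x = x₁ , x₂ ; o = o₁ , o₂ ; v = v₁ , v₂ ; w = w₁ , w₂ in
            (o ⊖ v) ⊗ (w ⊖ v) :* x₂ := (x ⊖ v) ⊗ (w ⊖ v) :* o₂ :+ (:- ((x ⊖ o) ⊗ (w ⊖ o)) :* v₂ :+ (x ⊖ o) ⊗
                (v ⊖ o) :* w₂)) refl x₁ x₂ o₁ o₂ v₁ v₂ w₁ w₂)

open RationalPlane

module LatticeWalks where

  open import Data.Integer using (+_; -[1+_]; ∣_∣)
  open ℤSolver.+-*-Solver

  -- The integers inside the rationals, and lattice vectors.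

  infix 25 _/1
  _/1 : ℤ → ℚ
  a /1 = a ℚ./ 1

  -- `_/1` reduces its fraction. Among unnormalised rationals the denominator is visibly 1, and the
  -- homomorphism laws become integer identities.
  toℚᵘ-/1 : ∀ a → toℚᵘ (a /1) ℚᵘ.≃ ℚᵘ.mkℚᵘ a 0
  toℚᵘ-/1 a = ℚₚ.toℚᵘ-fromℚᵘ (ℚᵘ.mkℚᵘ a 0)

  /1-homo-+ : ∀ a b → (a ℤ.+ b) /1 ≡ a /1 ℚ.+ b /1
  /1-homo-+ a b = ℚₚ.toℚᵘ-injective (ℚᵘₚ.≃-trans (toℚᵘ-/1 (a ℤ.+ b)) (ℚᵘₚ.≃-trans
    (ℚᵘ.*≡* (solve 2 (λ a b → (a :+ b) :* con (+ 1) := (a :* con (+ 1) :+ b :* con (+ 1)) :* con (+ 1)) refl a b))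
    (ℚᵘₚ.≃-sym (ℚᵘₚ.≃-trans (ℚₚ.toℚᵘ-homo-+ (a /1) (b /1)) (ℚᵘₚ.+-cong (toℚᵘ-/1 a) (toℚᵘ-/1 b))))))

  /1-homo-* : ∀ a b → (a ℤ.* b) /1 ≡ a /1 ℚ.* b /1
  /1-homo-* a b = ℚₚ.toℚᵘ-injective (ℚᵘₚ.≃-trans (toℚᵘ-/1 (a ℤ.* b)) (ℚᵘₚ.≃-trans
    (ℚᵘ.*≡* refl)
    (ℚᵘₚ.≃-sym (ℚᵘₚ.≃-trans (ℚₚ.toℚᵘ-homo-* (a /1) (b /1)) (ℚᵘₚ.*-cong (toℚᵘ-/1 a) (toℚᵘ-/1 b))))))

  /1-homo-neg : ∀ a → (ℤ.- a) /1 ≡ ℚ.- a /1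
  /1-homo-neg a = ℚₚ.toℚᵘ-injective (ℚᵘₚ.≃-trans (toℚᵘ-/1 (ℤ.- a))
    (ℚᵘₚ.≃-sym (ℚᵘₚ.≃-trans (ℚₚ.toℚᵘ-homo‿- (a /1)) (ℚᵘₚ.-‿cong (toℚᵘ-/1 a)))))

  /1-homo-- : ∀ a b → (a ℤ.- b) /1 ≡ a /1 ℚ.- b /1
  /1-homo-- a b = trans (/1-homo-+ a (ℤ.- b)) (cong (a /1 ℚ.+_) (/1-homo-neg b))

  /1-injective : ∀ {a b} → a /1 ≡ b /1 → a ≡ b
  /1-injective {a} {b} eq with ℚₚ.fromℚᵘ-injective {ℚᵘ.mkℚᵘ a 0} {ℚᵘ.mkℚᵘ b 0} eq
  ... | ℚᵘ.*≡* e = trans (sym (ℤₚ.*-identityʳ a)) (trans e (ℤₚ.*-identityʳ b))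

  /1-mono-< : ∀ {a b} → a ℤ.< b → a /1 ℚ.< b /1
  /1-mono-< {a} {b} a<b = ℚₚ.toℚᵘ-cancel-< (ℚᵘₚ.<-respˡ-≃ (ℚᵘₚ.≃-sym (toℚᵘ-/1 a)) (ℚᵘₚ.<-respʳ-≃ (ℚᵘₚ.≃-sym (toℚᵘ-/1 b))
    (ℚᵘ.*<* (subst₂ ℤ._<_ (sym (ℤₚ.*-identityʳ a)) (sym (ℤₚ.*-identityʳ b)) a<b))))

  toℚ²-sub : ∀ x y → toℚ² (x -ᶻ y) ≡ toℚ² x -ᵠ toℚ² y
  toℚ²-sub (a , b) (c , d) = cong₂ _,_ (/1-homo-- a c) (/1-homo-- b d)

  toℚ²-• : ∀ k x → toℚ² (k • x) ≡ (+ k) /1 *ᵠ toℚ² x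
  toℚ²-• k (a , b) = cong₂ _,_ (/1-homo-* (+ k) a) (/1-homo-* (+ k) b)

  infixr 7 _•ᶻ_
  _•ᶻ_ : ℤ → ℤ² → ℤ²
  k •ᶻ (a , b) = k ℤ.* a , k ℤ.* b

  /1-nonneg : ∀ a → 0ℚ ℚ.≤ a /1 → ∃[ k ] (a ≡ + k)
  /1-nonneg (+ k)    _    = k , refl
  /1-nonneg -[1+ k ] 0≤a = ⊥-elim (ℚₚ.<-irrefl refl (ℚₚ.<-≤-trans (/1-mono-< { -[1+ k ]} {+ 0} ℤ.-<+) 0≤a))

  toℚ²-•ᶻ : ∀ k x → toℚ² (k •ᶻ x) ≡ k /1 *ᵠ toℚ² x
  toℚ²-•ᶻ k (a , b) = cong₂ _,_ (/1-homo-* k a) (/1-homo-* k b)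

  toℚ²-injective : ∀ {x y} → toℚ² x ≡ toℚ² y → x ≡ y
  toℚ²-injective eq = cong₂ _,_ (/1-injective (cong proj₁ eq)) (/1-injective (cong proj₂ eq))

  infix 4 _≟ᶻ_
  _≟ᶻ_ : (x y : ℤ²) → Dec (x ≡ y)
  _≟ᶻ_ = ≡-dec ℤ._≟_ ℤ._≟_

  -ᶻ-swap : ∀ {a b c} → a ≡ b -ᶻ c → b -ᶻ a ≡ c
  -ᶻ-swap {_} {b₁ , b₂} {c₁ , c₂} refl = cong₂ _,_ (involution b₁ c₁) (involution b₂ c₂)
    where
    involution : ∀ b c → b ℤ.- (b ℤ.- c) ≡ c
    involution = solve 2 (λ b c → b :- (b :- c) := c) refl

  -ᶻ-swap⁻¹ : ∀ {a b c} → b -ᶻ a ≡ c → a ≡ b -ᶻ c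
  -ᶻ-swap⁻¹ {a} {b} refl = sym (-ᶻ-swap {b -ᶻ a} {b} {a} refl)

  -ᶻ-interchange : ∀ a b c d → (a -ᶻ b) -ᶻ (c -ᶻ d) ≡ (a -ᶻ c) -ᶻ (b -ᶻ d)
  -ᶻ-interchange (a₁ , a₂) (b₁ , b₂) (c₁ , c₂) (d₁ , d₂) = cong₂ _,_ (component a₁ b₁ c₁ d₁) (component a₂ b₂ c₂ d₂)
    where
    component : ∀ a b c d → (a ℤ.- b) ℤ.- (c ℤ.- d) ≡ (a ℤ.- c) ℤ.- (b ℤ.- d)
    component = solve 4 (λ a b c d → (a :- b) :- (c :- d) := (a :- c) :- (b :- d)) refl

  -ᶻ-cancelʳ : ∀ a b c → (a -ᶻ c) -ᶻ (b -ᶻ c) ≡ a -ᶻ b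
  -ᶻ-cancelʳ (a₁ , a₂) (b₁ , b₂) (c₁ , c₂) = cong₂ _,_ (component a₁ b₁ c₁) (component a₂ b₂ c₂)
    where
    component : ∀ a b c → (a ℤ.- c) ℤ.- (b ℤ.- c) ≡ a ℤ.- b
    component = solve 3 (λ a b c → (a :- c) :- (b :- c) := a :- b) refl

  -ᶻ-cancelˡ : ∀ {a b c} → a -ᶻ b ≡ a -ᶻ c → b ≡ c
  -ᶻ-cancelˡ {a} {b} {c} eq = trans (sym (-ᶻ-swap {a -ᶻ b} {a} {b} refl)) (-ᶻ-swap {a -ᶻ b} {a} {c} eq)

  •ᶻ-distribʳ : ∀ k l x → (k ℤ.- l) •ᶻ x ≡ (k •ᶻ x) -ᶻ (l •ᶻ x)
  •ᶻ-distribʳ k l (a , b) = cong₂ _,_ (component k l a) (component k l b)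
    where
    component : ∀ k l a → (k ℤ.- l) ℤ.* a ≡ k ℤ.* a ℤ.- l ℤ.* a
    component = solve 3 (λ k l a → (k :- l) :* a := k :* a :- l :* a) refl

  -- Multiples of a primitive vector.

  ∣∣-multiple : ∀ a → ∃[ s ] (+ ∣ a ∣ ≡ s ℤ.* a)
  ∣∣-multiple (+ n)    = + 1 , sym (ℤₚ.*-identityˡ (+ n))
  ∣∣-multiple -[1+ n ] = -[1+ 0 ] , sym (ℤₚ.-1*i≡-i -[1+ n ])

  bézout² : ∀ {e} → gcd² e ≡ 1 → ∃[ s ] ∃[ t ] (s ℤ.* proj₁ e ℤ.+ t ℤ.* proj₂ e ≡ + 1)
  bézout² {a , b} g with ∣∣-multiple a | ∣∣-multiple b | Bézout.identity (subst (GCD ∣ a ∣ ∣ b ∣) g (gcd-GCD ∣ a ∣ ∣ b ∣))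
  ... | s , ∣a∣≡ | t , ∣b∣≡ | Bézout.+- x y eq = + x ℤ.* s , ℤ.- (+ y ℤ.* t) , (begin
      + x ℤ.* s ℤ.* a ℤ.+ ℤ.- (+ y ℤ.* t) ℤ.* b
        ≡⟨ solve 6 (λ x s a y t b → x :* s :* a :+ :- (y :* t) :* b := x :* (s :* a) :- y :* (t :* b)) refl
            (+ x) s a (+ y) t b ⟩
      + x ℤ.* (s ℤ.* a) ℤ.- + y ℤ.* (t ℤ.* b)
        ≡⟨ cong₂ (λ A B → + x ℤ.* A ℤ.- + y ℤ.* B) (sym ∣a∣≡) (sym ∣b∣≡) ⟩
      + x ℤ.* + ∣ a ∣ ℤ.- + y ℤ.* + ∣ b ∣
        ≡⟨ cong₂ ℤ._-_ (trans (sym (ℤₚ.pos-* x ∣ a ∣)) (cong +_ (sym eq))) (sym (ℤₚ.pos-* y ∣ b ∣)) ⟩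
      + (1 ℕ.+ y ℕ.* ∣ b ∣) ℤ.- + (y ℕ.* ∣ b ∣)
        ≡⟨ cong (ℤ._- + (y ℕ.* ∣ b ∣)) (ℤₚ.pos-+ 1 (y ℕ.* ∣ b ∣)) ⟩
      + 1 ℤ.+ + (y ℕ.* ∣ b ∣) ℤ.- + (y ℕ.* ∣ b ∣)
        ≡⟨ solve 1 (λ z → con (+ 1) :+ z :- z := con (+ 1)) refl (+ (y ℕ.* ∣ b ∣)) ⟩
      + 1 ∎)
    where open ≡-Reasoning
  ... | s , ∣a∣≡ | t , ∣b∣≡ | Bézout.-+ x y eq = ℤ.- (+ x ℤ.* s) , + y ℤ.* t , (begin
      ℤ.- (+ x ℤ.* s) ℤ.* a ℤ.+ + y ℤ.* t ℤ.* b
        ≡⟨ solve 6 (λ x s a y t b → :- (x :* s) :* a :+ y :* t :* b := y :* (t :* b) :- x :* (s :* a)) refl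
            (+ x) s a (+ y) t b ⟩
      + y ℤ.* (t ℤ.* b) ℤ.- + x ℤ.* (s ℤ.* a)
        ≡⟨ cong₂ (λ A B → + y ℤ.* B ℤ.- + x ℤ.* A) (sym ∣a∣≡) (sym ∣b∣≡) ⟩
      + y ℤ.* + ∣ b ∣ ℤ.- + x ℤ.* + ∣ a ∣
        ≡⟨ cong₂ ℤ._-_ (trans (sym (ℤₚ.pos-* y ∣ b ∣)) (cong +_ (sym eq))) (sym (ℤₚ.pos-* x ∣ a ∣)) ⟩
      + (1 ℕ.+ x ℕ.* ∣ a ∣) ℤ.- + (x ℕ.* ∣ a ∣)
        ≡⟨ cong (ℤ._- + (x ℕ.* ∣ a ∣)) (ℤₚ.pos-+ 1 (x ℕ.* ∣ a ∣)) ⟩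
      + 1 ℤ.+ + (x ℕ.* ∣ a ∣) ℤ.- + (x ℕ.* ∣ a ∣)
        ≡⟨ solve 1 (λ z → con (+ 1) :+ z :- z := con (+ 1)) refl (+ (x ℕ.* ∣ a ∣)) ⟩
      + 1 ∎)
    where open ≡-Reasoning

  -- If `s a + t b = 1`, the multiple must be `s x + t y`: this value is forced by `z = k e`. The
  -- vanishing cross product exchanges `y a` for `x b`, which makes it correct in both coordinates.
  primitive-multiple : ∀ {e z} → gcd² e ≡ 1 → cross z e ≡ + 0 → ∃[ k ] (z ≡ k •ᶻ e)
  primitive-multiple {a , b} {x , y} g xb-ya≡0 with bézout² {a , b} g
  ... | s , t , sa+tb≡1 = s ℤ.* x ℤ.+ t ℤ.* y , sym (cong₂ _,_
    (begin
      (s ℤ.* x ℤ.+ t ℤ.* y) ℤ.* a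
        ≡⟨ solve 6 (λ s x t y a b → (s :* x :+ t :* y) :* a := (s :* a :+ t :* b) :* x :- t :* (x :* b :- y :* a))
            refl s x t y a b ⟩
      (s ℤ.* a ℤ.+ t ℤ.* b) ℤ.* x ℤ.- t ℤ.* (x ℤ.* b ℤ.- y ℤ.* a)
        ≡⟨ cong₂ (λ A B → A ℤ.* x ℤ.- t ℤ.* B) sa+tb≡1 xb-ya≡0 ⟩
      + 1 ℤ.* x ℤ.- t ℤ.* + 0
        ≡⟨ solve 2 (λ x t → con (+ 1) :* x :- t :* con (+ 0) := x) refl x t ⟩
      x ∎)
    (begin
      (s ℤ.* x ℤ.+ t ℤ.* y) ℤ.* b
        ≡⟨ solve 6 (λ s x t y a b → (s :* x :+ t :* y) :* b := (s :* a :+ t :* b) :* y :+ s :* (x :* b :- y :* a))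
            refl s x t y a b ⟩
      (s ℤ.* a ℤ.+ t ℤ.* b) ℤ.* y ℤ.+ s ℤ.* (x ℤ.* b ℤ.- y ℤ.* a)
        ≡⟨ cong₂ (λ A B → A ℤ.* y ℤ.+ s ℤ.* B) sa+tb≡1 xb-ya≡0 ⟩
      + 1 ℤ.* y ℤ.+ s ℤ.* + 0
        ≡⟨ solve 2 (λ y s → con (+ 1) :* y :+ s :* con (+ 0) := y) refl y s ⟩
      y ∎))
    where open ≡-Reasoning

  •ᶻ-injective : ∀ {e k l} → gcd² e ≡ 1 → k •ᶻ e ≡ l •ᶻ e → k ≡ l
  •ᶻ-injective {a , b} {k} {l} g eq with bézout² {a , b} g
  ... | s , t , sa+tb≡1 = trans (coefficient k) (trans (cong₂ (λ A B → s ℤ.* A ℤ.+ t ℤ.* B) (cong proj₁ eq)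
      (cong proj₂ eq)) (sym (coefficient l)))
    where
    coefficient : ∀ k → k ≡ s ℤ.* (k ℤ.* a) ℤ.+ t ℤ.* (k ℤ.* b)
    coefficient k = trans (sym (ℤₚ.*-identityʳ k)) (trans (cong (k ℤ.*_) (sym sa+tb≡1))
      (solve 5 (λ k s t a b → k :* (s :* a :+ t :* b) := s :* (k :* a) :+ t :* (k :* b)) refl k s t a b))

  -- Enumeration and number of lattice walks.

  lookup-injective : ∀ {A : Set} {xs : List A} → Unique xs → ∀ i j → lookup xs i ≡ lookup xs j → i ≡ j
  lookup-injective {xs = x ∷ xs} _ zero zero _ = refl
  lookup-injective {xs = x ∷ xs} (x∉ AllPairs.∷ _) zero (suc j) eq = ⊥-elim (All.lookup x∉ (∈-lookup j) eq)
  lookup-injective {xs = x ∷ xs} (x∉ AllPairs.∷ _) (suc i) zero eq = ⊥-elim (All.lookup x∉ (∈-lookup i) (sym eq))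
  lookup-injective {xs = x ∷ xs} (_ AllPairs.∷ u) (suc i) (suc j) eq = cong suc (lookup-injective u i j eq)

  -- Walks run through the cells of the arrays c₀, c₁, …; a list records the visited points, the last one first.
  module Walks (Region : ℤ² → Set) (region? : ∀ w → Dec (Region w)) (o : ℤ²) (n : ℕ → ℕ) (e : ℕ → ℤ²) where

    data Walk : ℕ → ℤ² → List ℤ² → Set where
      start : Walk 0 o (o ∷ [])
      step  : ∀ {i w ps} k → k ℕ.≤ n (suc i) → Region w →
              Walk i (w -ᶻ (k • e (suc i))) ps → Walk (suc i) w (w ∷ ps)

    -- The recursion on the multiplicity has the shape of `sumTo`, so the lengths obey the
    -- recurrence of `c` term by term.
    branches : (ℤ² → List (List ℤ²)) → ℤ² → ℤ² → ℕ → List (List ℤ²)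
    branches f d w zero    = map (w ∷_) (f (w -ᶻ (0 • d)))
    branches f d w (suc k) = branches f d w k ++ map (w ∷_) (f (w -ᶻ (suc k • d)))

    walks : ℕ → ℤ² → List (List ℤ²)
    walks zero w with w ≟ᶻ o
    ... | yes _ = (w ∷ []) ∷ []
    ... | no  _ = []
    walks (suc i) w with region? w
    ... | yes _ = branches (walks i) (e (suc i)) w (n (suc i))
    ... | no  _ = []

    ∈-branches⁻ : ∀ f d w k {ps} → ps ∈ branches f d w k →
      ∃[ j ] ∃[ qs ] (j ℕ.≤ k × ps ≡ w ∷ qs × qs ∈ f (w -ᶻ (j • d)))
    ∈-branches⁻ f d w zero ps∈ = let qs , qs∈ , eq = ∈-map⁻ (w ∷_) ps∈ in 0 , qs , z≤n , eq , qs∈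
    ∈-branches⁻ f d w (suc k) ps∈ with ∈-++⁻ (branches f d w k) ps∈
    ... | inj₁ ps∈ˡ = let j , qs , j≤k , rest = ∈-branches⁻ f d w k ps∈ˡ in j , qs , ℕₚ.m≤n⇒m≤1+n j≤k , rest
    ... | inj₂ ps∈ʳ = let qs , qs∈ , eq = ∈-map⁻ (w ∷_) ps∈ʳ in suc k , qs , ℕₚ.≤-refl , eq , qs∈

    ∈-branches⁺ : ∀ f d w {j} k {qs} → j ℕ.≤ k → qs ∈ f (w -ᶻ (j • d)) → w ∷ qs ∈ branches f d w k
    ∈-branches⁺ f d w zero z≤n qs∈ = ∈-map⁺ (w ∷_) qs∈
    ∈-branches⁺ f d w {j} (suc k) j≤1+k qs∈ with ℕₚ.m≤n⇒m<n∨m≡n j≤1+k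
    ... | inj₁ (s≤s j≤k) = ∈-++⁺ˡ (∈-branches⁺ f d w k j≤k qs∈)
    ... | inj₂ refl      = ∈-++⁺ʳ (branches f d w k) (∈-map⁺ (w ∷_) qs∈)

    walks-sound : ∀ i {w ps} → ps ∈ walks i w → Walk i w ps
    walks-sound zero {w} ps∈ with w ≟ᶻ o
    walks-sound zero (here refl) | yes refl = start
    walks-sound (suc i) {w} ps∈ with region? w
    ... | yes w∈R with ∈-branches⁻ (walks i) (e (suc i)) w (n (suc i)) ps∈
    ...   | k , qs , k≤n , refl , qs∈ = step k k≤n w∈R (walks-sound i qs∈)

    walks-complete : ∀ {i w ps} → Walk i w ps → ps ∈ walks i w
    walks-complete start with o ≟ᶻ o
    ... | yes _  = here refl
    ... | no o≢o = ⊥-elim (o≢o refl)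
    walks-complete (step {i} {w} k k≤n w∈R W) with region? w
    ... | yes _  = ∈-branches⁺ (walks i) (e (suc i)) w (n (suc i)) k≤n (walks-complete W)
    ... | no w∉R = ⊥-elim (w∉R w∈R)

    walk-head : ∀ {i w w′ ps} → Walk i w ps → Walk i w′ ps → w ≡ w′
    walk-head start start = refl
    walk-head (step _ _ _ _) (step _ _ _ _) = refl

    module _ (m : ℕ) (e-primitive : ∀ i → i ℕ.< m → gcd² (e (suc i)) ≡ 1) where

      -- The lists record points and not multiplicities. That `k` can be read off from the preceding
      -- point is what prevents two branches from producing the same list.
      step-injective : ∀ {i w j k} → i ℕ.< m → w -ᶻ (j • e (suc i)) ≡ w -ᶻ (k • e (suc i)) → j ≡ k
      step-injective {i} {w} i<m eq = ℤₚ.+-injective (•ᶻ-injective (e-primitive i i<m) (-ᶻ-cancelˡ {w} eq))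

      branches-unique : ∀ {i} → i ℕ.< m → (∀ w → Unique (walks i w)) →
        ∀ w k → Unique (branches (walks i) (e (suc i)) w k)
      branches-unique i<m u w zero = Unique.map⁺ ∷-injectiveʳ (u _)
      branches-unique {i} i<m u w (suc k) = Unique.++⁺ (branches-unique i<m u w k) (Unique.map⁺ ∷-injectiveʳ
          (u _)) disjoint
        where
        disjoint : ∀ {ps} → ¬ (ps ∈ branches (walks i) (e (suc i)) w k × ps ∈ map (w ∷_) (walks i (w -ᶻ (suc k • e
            (suc i)))))
        disjoint (ps∈ˡ , ps∈ʳ) with ∈-branches⁻ (walks i) (e (suc i)) w k ps∈ˡ | ∈-map⁻ (w ∷_) ps∈ʳ
        ... | j , qs , j≤k , refl , qs∈ | .qs , qs∈′ , refl =
          ℕₚ.<-irrefl (step-injective {w = w} i<m (walk-head (walks-sound i qs∈) (walks-sound i qs∈′))) (s≤s j≤k)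

      walks-unique : ∀ i → i ℕ.≤ m → ∀ w → Unique (walks i w)
      walks-unique zero _ w with w ≟ᶻ o
      ... | yes _ = All.[] AllPairs.∷ AllPairs.[]
      ... | no  _ = AllPairs.[]
      walks-unique (suc i) i<m w with region? w
      ... | yes _ = branches-unique i<m (walks-unique i (ℕₚ.<⇒≤ i<m)) w (n (suc i))
      ... | no  _ = AllPairs.[]

    module _ (m : ℕ) (c : ℕ → ℤ² → ℤ)
      (c-start : c 0 o ≡ + 1)
      (c-zero  : ∀ w → Region w → w ≢ o → c 0 w ≡ + 0)
      (c-out   : ∀ i w → i ℕ.≤ m → ¬ Region w → c i w ≡ + 0)
      (c-step  : ∀ i w → i ℕ.< m → Region w → c (suc i) w ≡ sumTo (n (suc i)) (λ k → c i (w -ᶻ (k • e (suc i)))))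
      where

      branches-length : ∀ {i} → (∀ w → + length (walks i w) ≡ c i w) → ∀ d w k →
        + length (branches (walks i) d w k) ≡ sumTo k (λ j → c i (w -ᶻ (j • d)))
      branches-length {i} ih d w zero = trans (cong +_ (length-map (w ∷_) (walks i (w -ᶻ (0 • d))))) (ih _)
      branches-length {i} ih d w (suc k) =
        trans (cong +_ (length-++ (branches (walks i) d w k)))
          (trans (ℤₚ.pos-+ (length (branches (walks i) d w k)) _)
            (cong₂ ℤ._+_ (branches-length ih d w k) (trans (cong +_ (length-map (w ∷_) (walks i (w -ᶻ
                (suc k • d))))) (ih _))))

      walks-length : ∀ i → i ℕ.≤ m → ∀ w → + length (walks i w) ≡ c i w
      walks-length zero _ w with w ≟ᶻ o
      ... | yes refl = sym c-start
      ... | no  w≢o with region? w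
      ...   | yes w∈R = sym (c-zero w w∈R w≢o)
      ...   | no  w∉R = sym (c-out 0 w z≤n w∉R)
      walks-length (suc i) i<m w with region? w
      ... | yes w∈R = trans (branches-length (walks-length i (ℕₚ.<⇒≤ i<m)) (e (suc i)) w (n (suc i))) (sym
          (c-step i w i<m w∈R))
      ... | no  w∉R = sym (c-out (suc i) w i<m w∉R)

    Steps : (ℕ → ℤ²) → ℕ → Set
    Steps q i = ∀ j → j ℕ.< i → ∃[ k ] (k ℕ.≤ n (suc j) × q j ≡ q (suc j) -ᶻ (k • e (suc j)))

    walk-path : ∀ {i w ps} → Walk i w ps →
      ∃[ q ] (q 0 ≡ o × q i ≡ w × Steps q i × ps ≡ map q (downFrom (suc i)))
    walk-path start = (λ _ → o) , refl , refl , (λ _ ()) , refl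
    walk-path (step {i} {w} k k≤n _ W) with walk-path W
    ... | q , q0 , qi , steps , refl = q′ , trans (q′-old z≤n) q0 , q′-new , steps′ ,
          cong₂ _∷_ (sym q′-new) (map-cong-local (All.tabulate λ j∈ → sym (q′-old (ℕ.s≤s⁻¹ (∈-downFrom⁻ j∈)))))
      where
      -- Only the values up to index `suc i` matter; beyond it the cell `w` is a default.
      q′ : ℕ → ℤ²
      q′ j with j ℕ.≤? i
      ... | yes _ = q j
      ... | no  _ = w
      q′-old : ∀ {j} → j ℕ.≤ i → q′ j ≡ q j
      q′-old {j} j≤i with j ℕ.≤? i
      ... | yes _   = refl
      ... | no  j≰i = ⊥-elim (j≰i j≤i)
      q′-new : q′ (suc i) ≡ w
      q′-new with suc i ℕ.≤? i
      ... | yes i<i = ⊥-elim (ℕₚ.<-irrefl refl i<i)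
      ... | no  _   = refl
      steps′ : Steps q′ (suc i)
      steps′ j (s≤s j≤i) with ℕₚ.m≤n⇒m<n∨m≡n j≤i
      ... | inj₁ j<i  = let l , l≤n , eq = steps j j<i in l , l≤n ,
        trans (q′-old j≤i) (trans eq (cong (_-ᶻ (l • e (suc j))) (sym (q′-old j<i))))
      ... | inj₂ refl = k , k≤n , trans (q′-old ℕₚ.≤-refl) (trans qi (cong (_-ᶻ (k • e (suc i))) (sym q′-new)))

    path-walk : ∀ {q} → q 0 ≡ o → ∀ i → Steps q i → (∀ j → j ℕ.≤ i → Region (q j)) →
      Walk i (q i) (map q (downFrom (suc i)))
    path-walk q0 zero _ _ rewrite q0 = start
    path-walk {q} q0 (suc i) steps inside =
      let k , k≤n , eq = steps i ℕₚ.≤-refl in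
      step k k≤n (inside (suc i) ℕₚ.≤-refl) (subst (λ w → Walk i w (map q (downFrom (suc i)))) eq
        (path-walk q0 i (λ j j<i → steps j (ℕₚ.m≤n⇒m≤1+n j<i)) (λ j j≤i → inside j (ℕₚ.m≤n⇒m≤1+n j≤i))))

open LatticeWalks

module Summands where

  open import Data.Integer using (+_)
  open import Data.Rational
  open import Data.Rational.Properties
  open ℚSolver.+-*-Solver

  -- Vector identities, and generators that minimise.

  toℚ²-cross : ∀ x y → cross x y /1 ≡ det (toℚ² x) (toℚ² y)
  toℚ²-cross (a , b) (c , d) = trans (/1-homo-- (a ℤ.* d) (b ℤ.* c)) (cong₂ _-_ (/1-homo-* a d) (/1-homo-* b c))

  -ᵠ-+ᵠ : ∀ x y → (x -ᵠ y) +ᵠ y ≡ x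
  -ᵠ-+ᵠ (x₁ , x₂) (y₁ , y₂) = ℚ²-ext (cancel x₁ y₁) (cancel x₂ y₂)
    where
    cancel : ∀ x y → x - y + y ≡ x
    cancel = solve 2 (λ x y → x :- y :+ y := x) refl

  +ᵠ--ᵠ : ∀ x y → x +ᵠ (y -ᵠ x) ≡ y
  +ᵠ--ᵠ (x₁ , x₂) (y₁ , y₂) = ℚ²-ext (cancel x₁ y₁) (cancel x₂ y₂)
    where
    cancel : ∀ x y → x + (y - x) ≡ y
    cancel = solve 2 (λ x y → x :+ (y :- x) := y) refl

  -ᵠ-zero⁻¹ : ∀ {x y} → x -ᵠ y ≡ 0ᵠ → x ≡ y
  -ᵠ-zero⁻¹ {x} {y} eq = trans (sym (-ᵠ-+ᵠ x y)) (trans (cong (_+ᵠ y) eq) (ℚ²-ext (+-identityˡ _) (+-identityˡ _)))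

  0≤-cancel-* : ∀ {a b} → 0ℚ < a → 0ℚ ≤ b * a → 0ℚ ≤ b
  0≤-cancel-* {a} {b} 0<a 0≤ba = *-cancelʳ-≤-pos a {{positive 0<a}} (subst (_≤ b * a) (sym (*-zeroˡ a)) 0≤ba)

  -- Any generator of positive weight will do: an excess over a bound could not be made up by the
  -- others. Thus a rational point that minimises two functionals is exchanged for a lattice point
  -- with the same values.
  cone-minimiser : ∀ {ps w x d₁ d₂ c₁ c₂} → Cone ps w x → 0ℚ < w →
    (∀ {p} → p ∈ ps → c₁ ≤ det (toℚ² p) d₁ × c₂ ≤ det (toℚ² p) d₂) →
    det x d₁ ≡ w * c₁ → det x d₂ ≡ w * c₂ →
    ∃[ p ] (p ∈ ps × det (toℚ² p) d₁ ≡ c₁ × det (toℚ² p) d₂ ≡ c₂)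
  cone-minimiser [] 0<0 _ _ _ = ⊥-elim (<-irrefl refl 0<0)
  cone-minimiser {d₁ = d₁} {d₂} {c₁} {c₂} (_∷_ {p = p} {r = r} {w} {x} 0≤r C) 0<w f eq₁ eq₂ with 0≤⇒≡⊎< 0≤r
  ... | inj₁ refl = let q , q∈ , rest = cone-minimiser C (subst (0ℚ <_) (+-identityˡ w) 0<w) (f ∘ there) (drop d₁ eq₁) (drop d₂ eq₂) in
        q , there q∈ , rest
    where
    drop : ∀ d {c} → det ((0ℚ *ᵠ toℚ² p) +ᵠ x) d ≡ (0ℚ + w) * c → det x d ≡ w * c
    drop d {c} eq = trans (cong (λ y → det y d) (sym (ℚ²-ext (absent (proj₁ (toℚ² p)) (proj₁ x)) (absent (proj₂
        (toℚ² p)) (proj₂ x)))))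
      (trans eq (cong (_* c) (+-identityˡ w)))
  ... | inj₂ 0<r = p , here refl , attained d₁ (proj₁ ∘ f) eq₁ , attained d₂ (proj₂ ∘ f) eq₂
    where
    attained : ∀ d {c} → (∀ {q} → q ∈ p ∷ _ → c ≤ det (toℚ² q) d) → det ((r *ᵠ toℚ² p) +ᵠ x) d ≡ (r + w) * c → det
        (toℚ² p) d ≡ c
    attained d {c} bound eq = ≤-antisym (*-cancelˡ-≤-pos r {{positive 0<r}} (0≤-diff (subst (0ℚ ≤_) excess (≤-diff
        (cone-bound (bound ∘ there) C))))) (bound (here refl))
      where
      excess : det x d - w * c ≡ r * c - r * det (toℚ² p) d
      excess = begin
        det x d - w * c ≡⟨ solve 5 (λ x w c r p → x :- w :* c := (r :* p :+ x) :- (r :+ w) :* c :+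
            (r :* c :- r :* p)) refl (det x d) w c r (det (toℚ² p) d) ⟩
        (r * det (toℚ² p) d + det x d) - (r + w) * c + (r * c - r * det (toℚ² p) d)
          ≡⟨ cong (λ y → y - (r + w) * c + (r * c - r * det (toℚ² p) d)) (trans (cong (_+ det x d) (sym (det-scale r
              (toℚ² p) d))) (trans (sym (det-add (r *ᵠ toℚ² p) x d)) eq)) ⟩
        (r + w) * c - (r + w) * c + (r * c - r * det (toℚ² p) d)
          ≡⟨ trans (cong (_+ (r * c - r * det (toℚ² p) d)) (+-inverseʳ ((r + w) * c))) (+-identityˡ _) ⟩
        r * c - r * det (toℚ² p) d ∎
        where open ≡-Reasoning

  -- The polygon P as an intersection of half-planes.

  module LatticePolygon (m′ : ℕ) (v : ℕ → ℤ²) (clockwise : ClockwiseConvex (suc m′) v)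
    (n : ℕ → ℕ) (e : ℕ → ℤ²)
    (edges : ∀ i → 1 ℕ.≤ i → i ℕ.≤ suc m′ → (n i ≡ gcd² (Edge v i)) × (Edge v i ≡ n i • e i) × (gcd² (e i) ≡ 1))
    where

    V : ℕ → ℚ²
    V = toℚ² ∘ v

    v-shift : ∀ i j → v (i ℕ.+ j ℕ.* suc m′) ≡ v i
    v-shift i zero    = cong v (ℕₚ.+-identityʳ i)
    v-shift i (suc j) = trans
      (cong v (trans (cong (i ℕ.+_) (ℕₚ.+-comm (suc m′) (j ℕ.* suc m′))) (sym (ℕₚ.+-assoc i (j ℕ.* suc m′) (suc m′)))))
      (trans (proj₁ (proj₂ clockwise) (i ℕ.+ j ℕ.* suc m′)) (v-shift i j))

    -- Convexity is given for base vertices below `m` only. Reducing `i` while keeping the offset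
    -- `k` outside moves a vertex together with its neighbours.
    v-% : ∀ k i → v (k ℕ.+ i) ≡ v (k ℕ.+ i ℕ.% suc m′)
    v-% k i = trans (cong v (trans (cong (k ℕ.+_) (ℕ.m≡m%n+[m/n]*n i (suc m′))) (sym (ℕₚ.+-assoc k (i ℕ.% suc m′) _))))
      (v-shift (k ℕ.+ i ℕ.% suc m′) (i ℕ./ suc m′))

    V-periodic : ∀ i → V (suc m′ ℕ.+ i) ≡ V i
    V-periodic i = cong toℚ² (trans (cong v (ℕₚ.+-comm (suc m′) i)) (proj₁ (proj₂ clockwise) i))

    V-convex : ∀ i d → 2 ℕ.≤ d → d ℕ.< suc m′ → 0ℚ < det (V (d ℕ.+ i) -ᵠ V i) (V (suc i) -ᵠ V i)
    V-convex i d 2≤d d<m =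
      subst₂ (λ a b → 0ℚ < det (a -ᵠ V i) (b -ᵠ V i)) (cong toℚ² (sym (v-% d i))) (cong toℚ² (sym (v-% 1 i)))
        (subst (λ c → 0ℚ < det (V (d ℕ.+ r) -ᵠ c) (V (suc r) -ᵠ c)) (cong toℚ² (sym (v-% 0 i)))
          (subst (0ℚ <_) negated (neg-antimono-< (/1-mono-< (proj₂ (proj₂ clockwise) r d (ℕ.m%n<n i (suc m′)) 2≤d d<m)))))
      where
      r = i ℕ.% suc m′
      negated : - (cross (v (suc r) -ᶻ v r) (v (r ℕ.+ d) -ᶻ v r) /1) ≡ det (V (d ℕ.+ r) -ᵠ V r) (V (suc r) -ᵠ V r)
      negated = begin
        - (cross (v (suc r) -ᶻ v r) (v (r ℕ.+ d) -ᶻ v r) /1)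
          ≡⟨ cong -_ (toℚ²-cross (v (suc r) -ᶻ v r) (v (r ℕ.+ d) -ᶻ v r)) ⟩
        - det (toℚ² (v (suc r) -ᶻ v r)) (toℚ² (v (r ℕ.+ d) -ᶻ v r))
          ≡⟨ sym (det-anti (toℚ² (v (r ℕ.+ d) -ᶻ v r)) (toℚ² (v (suc r) -ᶻ v r))) ⟩
        det (toℚ² (v (r ℕ.+ d) -ᶻ v r)) (toℚ² (v (suc r) -ᶻ v r))
          ≡⟨ cong₂ det (toℚ²-sub (v (r ℕ.+ d)) (v r)) (toℚ²-sub (v (suc r)) (v r)) ⟩
        det (V (r ℕ.+ d) -ᵠ V r) (V (suc r) -ᵠ V r)
          ≡⟨ cong (λ k → det (V k -ᵠ V r) (V (suc r) -ᵠ V r)) (ℕₚ.+-comm r d) ⟩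
        det (V (d ℕ.+ r) -ᵠ V r) (V (suc r) -ᵠ V r) ∎
        where open ≡-Reasoning

    open ConvexPolygon m′ V (proj₁ clockwise) V-periodic V-convex

    P : List ℤ²
    P = Polygon m v

    v∈P : ∀ i → v i ∈ P
    v∈P i = subst (_∈ P) (sym (v-% 0 i)) (∈-map⁺ v (∈-upTo⁺ (ℕ.m%n<n i m)))

    D-% : ∀ i → D i ≡ D (i ℕ.% m)
    D-% i = cong₂ _-ᵠ_ (cong toℚ² (v-% 1 i)) (cong toℚ² (v-% 0 i))

    hull-inside : ∀ {x} → Hull P x → ∀ i → det (V i) (D i) ≤ det x (D i)
    hull-inside {x} C i = subst₂ _≤_ (sym (cong₂ det (cong toℚ² (v-% 0 i)) (D-% i))) (sym (cong (det x) (D-% i)))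
      (hull-bound (λ p∈P → let j , j∈ , p≡ = ∈-map⁻ v p∈P in
        subst (λ p → det (V r) (D r) ≤ det (toℚ² p) (D r)) (sym p≡)
          (circuit-support boundary r j (ℕₚ.<⇒≤ (ℕ.m%n<n i m)) (ℕₚ.<⇒≤ (∈-upTo⁻ j∈)))) C)
      where r = i ℕ.% m

    inside-hull : ∀ {x} → (∀ i → i ℕ.< m → det (V i) (D i) ≤ det x (D i)) → Hull P x
    inside-hull {x} inside = hull-normalise 0<total (subst₂ (Cone P)
      (cong₂ _+_ (*-identityʳ a) (cong₂ _+_ (*-identityʳ b) (*-identityʳ c)))
      (sym barycentric)
      (cone-+ (cone-* 0≤a (hull-∈ (v∈P 0))) (cone-+ (cone-* 0≤b (hull-∈ (v∈P index))) (cone-* 0≤c (hull-∈ (v∈P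
          (suc index)))))))
      where open InFan (fan x inside)

    -- Membership by weights is an existential statement; the half-planes reduce it to finitely many
    -- comparisons. The walks must decide it, because `c` obeys different rules inside and outside
    -- P.
    region? : ∀ w → Dec (InHull P (toℚ² w))
    region? w = Dec.map′ (λ inside → Hull⇒InHull (inside-hull λ i i<m → inside i<m)) (λ C {i} _ → hull-inside
        (InHull⇒Hull C) i)
      (ℕₚ.allUpTo? (λ i → det (V i) (D i) ≤? det (toℚ² w) (D i)) m)

    -- Edges as multiples of primitive vectors.

    ε : ℕ → ℚ²
    ε j = toℚ² (e (suc j))

    ν : ℕ → ℚ
    ν j = (+ n (suc j)) /1

    edge-multiple : ∀ {j} → j ℕ.< m → v (suc j) -ᶻ v j ≡ n (suc j) • e (suc j)
    edge-multiple {j} j<m = proj₁ (proj₂ (edges (suc j) (s≤s z≤n) j<m))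

    e-primitive : ∀ j → j ℕ.< m → gcd² (e (suc j)) ≡ 1
    e-primitive j j<m = proj₂ (proj₂ (edges (suc j) (s≤s z≤n) j<m))

    D-multiple : ∀ {j} → j ℕ.< m → D j ≡ ν j *ᵠ ε j
    D-multiple {j} j<m = trans (sym (toℚ²-sub (v (suc j)) (v j))) (trans (cong toℚ² (edge-multiple j<m)) (toℚ²-• (n
        (suc j)) (e (suc j))))

    -- An edge of length zero would annul the strict turn at its end.
    0<ν : ∀ {j} → j ℕ.< m → 0ℚ < ν j
    0<ν {j} j<m = [ (λ ν≡0 → ⊥-elim (<-irrefl refl (subst (0ℚ <_) (flat ν≡0) (turn j)))) , (λ 0<ν → 0<ν) ]′ (0≤⇒≡⊎< 0≤ν)
      where
      0≤ν : 0ℚ ≤ ν j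
      0≤ν = nonNegative⁻¹ (ν j) {{normalize-nonNeg (n (suc j)) 1}}
      flat : ν j ≡ 0ℚ → det (D (suc j)) (D j) ≡ 0ℚ
      flat ν≡0 = begin
        det (D (suc j)) (D j)           ≡⟨ det-anti (D (suc j)) (D j) ⟩
        - det (D j) (D (suc j))         ≡⟨ cong (λ d → - det d (D (suc j))) (trans (D-multiple j<m) (cong
            (_*ᵠ ε j) ν≡0)) ⟩
        - det (0ℚ *ᵠ ε j) (D (suc j))   ≡⟨ cong -_ (trans (det-scale 0ℚ (ε j) (D (suc j))) (*-zeroˡ (det (ε j) (D
            (suc j))))) ⟩
        0ℚ ∎
        where open ≡-Reasoning

    0<turn-ε : ∀ {j} → j ℕ.< m → 0ℚ < - det (ε j) (D (suc j))
    0<turn-ε {j} j<m = *-cancelˡ-<-nonNeg (ν j) {{nonNegative (<⇒≤ (0<ν j<m))}} (subst₂ _<_ (sym (*-zeroʳ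
        (ν j))) scaled (turn j))
      where
      scaled : det (D (suc j)) (D j) ≡ ν j * - det (ε j) (D (suc j))
      scaled = trans (det-anti (D (suc j)) (D j)) (trans (cong (λ d → - det d (D (suc j))) (D-multiple j<m))
        (trans (cong -_ (det-scale (ν j) (ε j) (D (suc j)))) (neg-distribʳ-* (ν j) (det (ε j) (D (suc j))))))

    parallel-multiple : ∀ {j z} → j ℕ.< m → det (toℚ² z) (D j) ≡ 0ℚ → ∃[ κ ] (z ≡ κ •ᶻ e (suc j))
    parallel-multiple {j} {z} j<m parallel = primitive-multiple {e (suc j)} {z} (e-primitive j j<m)
      (/1-injective (trans (toℚ²-cross z (e (suc j))) (*-cancel-0 (0<ν j<m) (begin
        ν j * det (toℚ² z) (ε j)     ≡⟨ cong (ν j *_) (det-anti (toℚ² z) (ε j)) ⟩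
        ν j * - det (ε j) (toℚ² z)   ≡⟨ sym (neg-distribʳ-* (ν j) (det (ε j) (toℚ² z))) ⟩
        - (ν j * det (ε j) (toℚ² z)) ≡⟨ cong -_ (sym (det-scale (ν j) (ε j) (toℚ² z))) ⟩
        - det (ν j *ᵠ ε j) (toℚ² z)  ≡⟨ sym (det-anti (toℚ² z) (ν j *ᵠ ε j)) ⟩
        det (toℚ² z) (ν j *ᵠ ε j)    ≡⟨ cong (det (toℚ² z)) (sym (D-multiple j<m)) ⟩
        det (toℚ² z) (D j)           ≡⟨ parallel ⟩
        0ℚ ∎))))
      where open ≡-Reasoning

    multiple-nonneg : ∀ {j} κ → j ℕ.< m → det (toℚ² (κ •ᶻ e (suc j))) (D (suc j)) ≤ 0ℚ → 0ℚ ≤ κ /1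
    multiple-nonneg {j} κ j<m ≤0 = 0≤-cancel-* (0<turn-ε j<m) (subst (0ℚ ≤_) (begin
        - det (toℚ² (κ •ᶻ e (suc j))) (D (suc j)) ≡⟨ cong (λ y → - det y (D (suc j))) (toℚ²-•ᶻ κ (e (suc j))) ⟩
        - det (κ /1 *ᵠ ε j) (D (suc j))      ≡⟨ cong -_ (det-scale (κ /1) (ε j) (D (suc j))) ⟩
        - (κ /1 * det (ε j) (D (suc j)))     ≡⟨ neg-distribʳ-* (κ /1) (det (ε j) (D (suc j))) ⟩
        κ /1 * - det (ε j) (D (suc j)) ∎) (neg-antimono-≤ ≤0))
      where open ≡-Reasoning

    -- Edge `j` fixes the line of `z`, and the next edge its direction, since the height over that
    -- edge decreases along `ε j`.
    step-multiple : ∀ {j z} → j ℕ.< m → det (toℚ² z) (D j) ≡ 0ℚ → det (toℚ² z) (D (suc j)) ≤ 0ℚ → ∃[ k ] (z ≡ k • e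
        (suc j))
    step-multiple {j} {z} j<m parallel ≤0 =
      let κ , z≡  = parallel-multiple {z = z} j<m parallel
          k , κ≡k = /1-nonneg κ (multiple-nonneg κ j<m (subst (λ y → det (toℚ² y) (D (suc j)) ≤ 0ℚ) z≡ ≤0))
      in k , trans z≡ (cong (_•ᶻ e (suc j)) κ≡k)

    -- Closed chains and the summands that they span.

    record SubChain (q : ℕ → ℤ²) : Set where
      field
        closed : q m ≡ q 0
        edge   : ∀ j → j ℕ.< m → ∃[ k ] (k ℕ.≤ n (suc j) × q (suc j) -ᶻ q j ≡ k • e (suc j))

    complement : (ℕ → ℤ²) → ℕ → ℤ²
    complement q j = v j -ᶻ q j

    complement-chain : ∀ {q} → SubChain q → SubChain (complement q)
    complement-chain {q} Q = record
      { closed = cong₂ _-ᶻ_ (proj₁ (proj₂ clockwise) 0) closed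
      ; edge   = λ j j<m → let k , k≤n , q≡ = edge j j<m in
          n (suc j) ℕ.∸ k , ℕₚ.m∸n≤m (n (suc j)) k ,
          trans (-ᶻ-interchange (v (suc j)) (q (suc j)) (v j) (q j))
            (trans (cong₂ _-ᶻ_ (edge-multiple j<m) q≡)
              (trans (sym (•ᶻ-distribʳ (+ n (suc j)) (+ k) (e (suc j))))
                (cong (_•ᶻ e (suc j)) (trans (ℤₚ.m-n≡m⊖n (n (suc j)) k) (ℤₚ.⊖-≥ k≤n)))))
      }
      where open SubChain Q

    -- The indices run from `m` down to 0. The closing point appears twice, so that this is exactly
    -- the list recorded by a walk of `m` steps.
    points : (ℕ → ℤ²) → List ℤ²
    points q = map q (downFrom (suc m))

    ∈-points⁻ : ∀ q {p} → p ∈ points q → ∃[ j ] (j ℕ.≤ m × p ≡ q j)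
    ∈-points⁻ q p∈ = let j , j∈ , p≡ = ∈-map⁻ q p∈ in j , ℕ.s≤s⁻¹ (∈-downFrom⁻ j∈) , p≡

    ∈-points⁺ : ∀ q {j} → j ℕ.≤ m → q j ∈ points q
    ∈-points⁺ q j≤m = ∈-map⁺ q (∈-downFrom⁺ (s≤s j≤m))

    complement-sum : ∀ q j → toℚ² (q j) +ᵠ toℚ² (complement q j) ≡ V j
    complement-sum q j = trans (cong (toℚ² (q j) +ᵠ_) (toℚ²-sub (v j) (q j))) (+ᵠ--ᵠ (toℚ² (q j)) (V j))

    -- This inclusion holds for every sequence `q`, since points of equal index add up to a vertex;
    -- only the reverse inclusion uses the steps of a chain.
    polygon-split : ∀ q {x} → Hull P x → ∃[ y ] ∃[ z ] (Hull (points q) y × Hull (points (complement q)) z × x ≡ y +ᵠ z)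
    polygon-split q = cone-split λ p∈P → let j , j∈ , p≡ = ∈-map⁻ v p∈P ; j≤m = ℕₚ.<⇒≤ (∈-upTo⁻ j∈) in
      toℚ² (q j) , toℚ² (complement q j) , hull-∈ (∈-points⁺ q j≤m) , hull-∈ (∈-points⁺ (complement q) j≤m) ,
      trans (cong toℚ² p≡) (sym (complement-sum q j))

    module _ {q : ℕ → ℤ²} (Q : SubChain q) where
      open SubChain Q

      q-% : ∀ {j} → j ℕ.≤ m → q (j ℕ.% m) ≡ q j
      q-% {j} j≤m with ℕₚ.m≤n⇒m<n∨m≡n j≤m
      ... | inj₁ j<m  = cong q (ℕ.m<n⇒m%n≡m j<m)
      ... | inj₂ refl = trans (cong q (ℕ.n%n≡0 m)) (sym closed)

      q-suc : ∀ {j} (j<m : j ℕ.< m) → toℚ² (q (suc j)) ≡ toℚ² (q j) +ᵠ ((+ proj₁ (edge j j<m)) /1 *ᵠ ε j)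
      q-suc {j} j<m = let k , _ , q≡ = edge j j<m in
        trans (sym (+ᵠ--ᵠ (toℚ² (q j)) (toℚ² (q (suc j)))))
          (cong (toℚ² (q j) +ᵠ_) (trans (sym (toℚ²-sub (q (suc j)) (q j))) (trans (cong toℚ² q≡) (toℚ²-• k (e (suc j))))))

      chain-circuit : Circuit (λ j → toℚ² (q (j ℕ.% m)))
      chain-circuit = record
        { closed = λ i → cong (toℚ² ∘ q) (trans (cong (ℕ._% m) (ℕₚ.+-comm m i)) (ℕ.[m+n]%n≡m%n i m))
        ; edge   = λ i → let r = i ℕ.% m ; r<m = ℕ.m%n<n i m ; k , _ = edge r r<m in
            -- A step of `k` primitive vectors is the fraction `k / n` of the whole edge.
            (+ k) /1 * 1/ν r<m ,
            0≤-* (nonNegative⁻¹ ((+ k) /1) {{normalize-nonNeg k 1}}) (<⇒≤ (positive⁻¹ (1/ν r<m) {{1/pos⇒pos (ν r)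
                {{positive (0<ν r<m)}}}})) ,
            trans (cong toℚ² (trans (cong q (suc-% i)) (q-% r<m)))
              (trans (q-suc r<m) (cong (toℚ² (q r) +ᵠ_) (sym (trans (cong (((+ k) /1 * 1/ν r<m) *ᵠ_) (trans (D-% i)
                  (D-multiple r<m)))
                (ℚ²-ext (scale r<m k (proj₁ (ε r))) (scale r<m k (proj₂ (ε r))))))))
        }
        where
        1/ν : ∀ {j} → j ℕ.< m → ℚ
        1/ν {j} j<m = (1/ ν j) {{pos⇒nonZero (ν j) {{positive (0<ν j<m)}}}}
        scale : ∀ {j} (j<m : j ℕ.< m) k a → ((+ k) /1 * 1/ν j<m) * (ν j * a) ≡ (+ k) /1 * a
        scale {j} j<m k a = trans (solve 4 (λ k i ν a → (k :* i) :* (ν :* a) := (k :* a) :* (i :* ν)) refl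
            ((+ k) /1) (1/ν j<m) (ν j) a)
          (trans (cong (((+ k) /1 * a) *_) (*-inverseˡ (ν j) {{pos⇒nonZero (ν j) {{positive (0<ν j<m)}}}}))
              (*-identityʳ _))
        suc-% : ∀ i → suc i ℕ.% m ≡ suc (i ℕ.% m) ℕ.% m
        suc-% i = trans (cong (λ j → suc j ℕ.% m) (ℕ.m≡m%n+[m/n]*n i m)) (ℕ.[m+kn]%n≡m%n (suc (i ℕ.% m)) (i ℕ./ m) m)

      chain-support : ∀ {i j} → i ℕ.≤ m → j ℕ.≤ m → det (toℚ² (q i)) (D i) ≤ det (toℚ² (q j)) (D i)
      chain-support {i} {j} i≤m j≤m = subst₂ (λ a b → det (toℚ² a) (D i) ≤ det (toℚ² b) (D i)) (q-% i≤m) (q-% j≤m)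
        (circuit-support chain-circuit i j i≤m j≤m)

      chain-edge : ∀ {i} → i ℕ.< m → det (toℚ² (q (suc i))) (D i) ≡ det (toℚ² (q i)) (D i)
      chain-edge {i} i<m = begin
        det (toℚ² (q (suc i))) (D i)                       ≡⟨ cong (λ x → det x (D i)) (q-suc i<m) ⟩
        det (toℚ² (q i) +ᵠ (κ *ᵠ ε i)) (D i)               ≡⟨ det-add (toℚ² (q i)) (κ *ᵠ ε i) (D i) ⟩
        det (toℚ² (q i)) (D i) + det (κ *ᵠ ε i) (D i)        ≡⟨ cong (λ y → det (toℚ² (q i)) (D i) + y) parallel ⟩
        det (toℚ² (q i)) (D i) + 0ℚ                        ≡⟨ +-identityʳ _ ⟩
        det (toℚ² (q i)) (D i) ∎
        where
        open ≡-Reasoning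
        κ = (+ proj₁ (edge i i<m)) /1
        proportional : ∀ a b z → det (a *ᵠ z) (b *ᵠ z) ≡ 0ℚ
        proportional a b (z₁ , z₂) = solve 4 (λ a b z₁ z₂ → (a :* z₁ , a :* z₂) ⊗ (b :* z₁ , b :* z₂) := con 0ℚ)
            refl a b z₁ z₂
        parallel : det (κ *ᵠ ε i) (D i) ≡ 0ℚ
        parallel = trans (cong (det (κ *ᵠ ε i)) (D-multiple i<m)) (proportional κ (ν i) (ε i))

      points-support : ∀ {i x} → i ℕ.≤ m → Hull (points q) x → det (toℚ² (q i)) (D i) ≤ det x (D i)
      points-support {i} i≤m = hull-bound λ p∈ → let j , j≤m , p≡ = ∈-points⁻ q p∈ in
        subst (λ p → det (toℚ² (q i)) (D i) ≤ det (toℚ² p) (D i)) (sym p≡) (chain-support i≤m j≤m)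

    module _ {q : ℕ → ℤ²} (Q : SubChain q) where
      private Q′ = complement-chain Q

      sum-in-hull : ∀ {i j} → i ℕ.≤ m → j ℕ.≤ m → Hull P (toℚ² (q i) +ᵠ toℚ² (complement q j))
      sum-in-hull {i} {j} i≤m j≤m = inside-hull λ l l<m → subst₂ _≤_
        (trans (sym (det-add (toℚ² (q l)) (toℚ² (complement q l)) (D l))) (cong (λ x → det x (D l)) (complement-sum q l)))
        (sym (det-add (toℚ² (q i)) (toℚ² (complement q j)) (D l)))
        (+-mono-≤ (chain-support Q (ℕₚ.<⇒≤ l<m) i≤m) (chain-support Q′ (ℕₚ.<⇒≤ l<m) j≤m))

      chain-summand : IsSummand P (points q)
      chain-summand = (λ ()) , points (complement q) , (λ ()) , λ x →
        (λ C → let y , z , Y , Z , x≡ = polygon-split q (InHull⇒Hull C) in y , z , Hull⇒InHull Y , Hull⇒InHull Z , x≡) ,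
        (λ (y , z , Y , Z , x≡) → subst (InHull P) (sym x≡) (Hull⇒InHull (hull-minkowski
          (λ q∈ r∈ → let i , i≤m , q≡ = ∈-points⁻ q q∈ ; j , j≤m , r≡ = ∈-points⁻ (complement q) r∈ in
            subst₂ (λ a b → Hull P (toℚ² a +ᵠ toℚ² b)) (sym q≡) (sym r≡) (sum-in-hull i≤m j≤m))
          (InHull⇒Hull Y) (InHull⇒Hull Z))))

      -- The complementary chain starts at the origin, so `q j` is already a sum of points of both
      -- chains.
      chain-in-hull : q 0 ≡ v 0 → ∀ {j} → j ℕ.≤ m → Hull P (toℚ² (q j))
      chain-in-hull q0 {j} j≤m = subst (Hull P)
        (trans (cong (toℚ² (q j) +ᵠ_) origin) (+ᵠ-identityʳ (toℚ² (q j)))) (sum-in-hull j≤m z≤n)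
        where
        origin : toℚ² (complement q 0) ≡ 0ᵠ
        origin = trans (toℚ²-sub (v 0) (q 0)) (trans (cong (λ w → V 0 -ᵠ toℚ² w) q0) (ℚ²-ext (+-inverseʳ (proj₁
            (V 0))) (+-inverseʳ (proj₂ (V 0)))))

    -- A translation shifts all support values det (q i) (D i), and two consecutive ones determine a vertex.
    translate-unique : ∀ {q q′} → SubChain q → SubChain q′ → q 0 ≡ q′ 0 → Translate (points q)
        (points q′) → points q ≡ points q′
    translate-unique {q} {q′} Q Q′ q0≡ (t , translate) = map-cong-local (All.tabulate λ j∈ → equal _ (ℕ.s≤s⁻¹
        (∈-downFrom⁻ j∈)))
      where
      support : ∀ {i} → i ℕ.≤ m → det (toℚ² (q′ i) -ᵠ t) (D i) ≡ det (toℚ² (q i)) (D i)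
      support {i} i≤m = ≤-antisym
        (subst₂ _≤_ (sym (det-sub (toℚ² (q′ i)) t (D i)))
          (trans (cong (_- det t (D i)) (det-add (toℚ² (q i)) t (D i))) (solve 2 (λ a b → a :+ b :- b := a) refl
              (det (toℚ² (q i)) (D i)) (det t (D i))))
          (+-monoˡ-≤ (- det t (D i)) (points-support Q′ i≤m (InHull⇒Hull (proj₂ (translate (toℚ² (q i) +ᵠ t))
            (subst (InHull (points q)) (sym (+ᵠ-t (toℚ² (q i)))) (Hull⇒InHull (hull-∈ (∈-points⁺ q i≤m)))))))))
        (points-support Q i≤m (InHull⇒Hull (proj₁ (translate (toℚ² (q′ i))) (Hull⇒InHull (hull-∈ (∈-points⁺ q′ i≤m))))))
        where
        +ᵠ-t : ∀ x → (x +ᵠ t) -ᵠ t ≡ x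
        +ᵠ-t x = ℚ²-ext (cancel (proj₁ x) (proj₁ t)) (cancel (proj₂ x) (proj₂ t))
          where
          cancel : ∀ a b → a + b - b ≡ a
          cancel = solve 2 (λ a b → a :+ b :- b := a) refl
      support-edge : ∀ {i} → i ℕ.< m → det (toℚ² (q′ (suc i)) -ᵠ t) (D i) ≡ det (toℚ² (q (suc i))) (D i)
      support-edge {i} i<m = begin
        det (toℚ² (q′ (suc i)) -ᵠ t) (D i)          ≡⟨ det-sub (toℚ² (q′ (suc i))) t (D i) ⟩
        det (toℚ² (q′ (suc i))) (D i) - det t (D i)   ≡⟨ cong (_- det t (D i)) (chain-edge Q′ i<m) ⟩
        det (toℚ² (q′ i)) (D i) - det t (D i)         ≡⟨ sym (det-sub (toℚ² (q′ i)) t (D i)) ⟩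
        det (toℚ² (q′ i) -ᵠ t) (D i)                ≡⟨ support (ℕₚ.<⇒≤ i<m) ⟩
        det (toℚ² (q i)) (D i)                      ≡⟨ sym (chain-edge Q i<m) ⟩
        det (toℚ² (q (suc i))) (D i) ∎
        where open ≡-Reasoning
      shifted : ∀ {i} → i ℕ.< m → toℚ² (q′ (suc i)) -ᵠ t ≡ toℚ² (q (suc i))
      shifted {i} i<m = -ᵠ-zero⁻¹ (det-nondegenerate (turn i)
        (det-difference {toℚ² (q′ (suc i)) -ᵠ t} {toℚ² (q (suc i))} (support i<m))
        (det-difference {toℚ² (q′ (suc i)) -ᵠ t} {toℚ² (q (suc i))} (support-edge i<m)))
      -- `shifted` only reaches vertices of positive index, so the common base point is used at
      -- index `m`, where both chains have closed.
      last : q′ m ≡ q m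
      last = trans (SubChain.closed Q′) (trans (sym q0≡) (sym (SubChain.closed Q)))
      t≡0 : t ≡ 0ᵠ
      t≡0 = ℚ²-ext (cancel (cong proj₁ fixed)) (cancel (cong proj₂ fixed))
        where
        fixed : toℚ² (q m) -ᵠ t ≡ toℚ² (q m)
        fixed = trans (cong (λ w → toℚ² w -ᵠ t) (sym last)) (shifted ℕₚ.≤-refl)
        cancel : ∀ {a b} → a - b ≡ a → b ≡ 0ℚ
        cancel {a} {b} eq = trans (solve 2 (λ a b → b := a :- (a :- b)) refl a b) (trans (cong (λ c → a - c) eq)
            (+-inverseʳ a))
      equal : ∀ j → j ℕ.≤ m → q j ≡ q′ j
      equal zero    _   = q0≡
      equal (suc i) i<m = toℚ²-injective (trans (sym (shifted i<m)) (trans (cong (λ s → toℚ² (q′ (suc i)) -ᵠ s) t≡0)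
        (+ᵠ-identityʳ (toℚ² (q′ (suc i))))))

    -- Modulo `m` the index `m′ + j` is `j - 1`, so `before` concerns the edge that ends at vertex
    -- `j`. The notion serves both factors: Q with its vertices, and R with their complements.
    record Supported (L : List ℤ²) (f : ℕ → ℤ²) : Set where
      field
        member : ∀ j → Hull L (toℚ² (f j))
        after  : ∀ j {y} → Hull L y → det (toℚ² (f j)) (D j) ≤ det y (D j)
        before : ∀ j {y} → Hull L y → det (toℚ² (f j)) (D (m′ ℕ.+ j)) ≤ det y (D (m′ ℕ.+ j))

    module _ {L : List ℤ²} {f : ℕ → ℤ²} (S : Supported L f) where
      open Supported S

      supported-parallel : ∀ j → det (toℚ² (f (suc j) -ᶻ f j)) (D j) ≡ 0ℚ
      supported-parallel j = trans (cong (λ x → det x (D j)) (toℚ²-sub (f (suc j)) (f j)))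
        (det-difference {toℚ² (f (suc j))} {toℚ² (f j)} {D j} equal)
        where
        D≡ : D (m′ ℕ.+ suc j) ≡ D j
        D≡ = trans (cong D (ℕₚ.+-suc m′ j)) (D-periodic j)
        equal : det (toℚ² (f (suc j))) (D j) ≡ det (toℚ² (f j)) (D j)
        equal = ≤-antisym
          (subst (λ d → det (toℚ² (f (suc j))) d ≤ det (toℚ² (f j)) d) D≡ (before (suc j) (member j)))
          (after j (member (suc j)))

      supported-step : ∀ {j} → j ℕ.< m → ∃[ k ] (f (suc j) -ᶻ f j ≡ k • e (suc j))
      supported-step {j} j<m = step-multiple {z = f (suc j) -ᶻ f j} j<m (supported-parallel j) (subst (_≤ 0ℚ)
        (sym (trans (cong (λ x → det x (D (suc j))) (toℚ²-sub (f (suc j)) (f j))) (det-sub (toℚ² (f (suc j))) (toℚ²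
            (f j)) (D (suc j)))))
        (subst (det (toℚ² (f (suc j))) (D (suc j)) - det (toℚ² (f j)) (D (suc j)) ≤_) (+-inverseʳ (det (toℚ² (f j))
            (D (suc j))))
          (+-monoˡ-≤ (- det (toℚ² (f j)) (D (suc j))) (after (suc j) (member j)))))

      -- The values of `f` may be chosen index by index, so periodicity is not automatic. But `f m`
      -- and `f 0` minimise the same two independent functionals.
      supported-closed : f m ≡ f 0
      supported-closed = toℚ²-injective (-ᵠ-zero⁻¹ (det-nondegenerate (turn m′)
        (vanish (after m) (λ {y} L∋y → subst (λ d → det (toℚ² (f 0)) d ≤ det y d) (sym D-wrap) (after 0 L∋y)))
        (vanish (λ {y} L∋y → subst (λ d → det (toℚ² (f m)) d ≤ det y d) (trans (cong D (ℕₚ.+-comm m′ m))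
            (D-periodic m′)) (before m L∋y))
                (λ {y} L∋y → subst (λ d → det (toℚ² (f 0)) d ≤ det y d) (cong D (ℕₚ.+-identityʳ m′)) (before 0 L∋y)))))
        where
        D-wrap : D m ≡ D 0
        D-wrap = trans (cong D (sym (ℕₚ.+-identityʳ m))) (D-periodic 0)
        vanish : ∀ {d} → (∀ {y} → Hull L y → det (toℚ² (f m)) d ≤ det y d) → (∀ {y} → Hull L y → det (toℚ²
            (f 0)) d ≤ det y d) →
          det (toℚ² (f m) -ᵠ toℚ² (f 0)) d ≡ 0ℚ
        vanish {d} min min₀ = det-difference {toℚ² (f m)} {toℚ² (f 0)} {d} (≤-antisym (min (member 0)) (min₀ (member m)))

    -- The upper bound on a step comes from the other factor: along the same edge its step is
    -- `n - k` primitive vectors, and this multiple is nonnegative too.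
    supported-chain : ∀ {Q R q} → Supported Q q → Supported R (complement q) → SubChain q
    supported-chain {q = q} S T = record
      { closed = supported-closed S
      ; edge   = λ j j<m → let k , q≡ = supported-step S j<m ; l , r≡ = supported-step T j<m in
          k , bound {k = k} {l} j<m q≡ r≡ , q≡
      }
      where
      bound : ∀ {j k l} → j ℕ.< m → q (suc j) -ᶻ q j ≡ k • e (suc j) →
        complement q (suc j) -ᶻ complement q j ≡ l • e (suc j) → k ℕ.≤ n (suc j)
      bound {j} {k} {l} j<m q≡ r≡ = ℤₚ.drop‿+≤+ (ℤₚ.0≤i-j⇒j≤i (subst (+ 0 ℤ.≤_) (sym n-k≡l) (ℤ.+≤+ z≤n)))
        where
        n-k≡l : + n (suc j) ℤ.- + k ≡ + l
        n-k≡l = •ᶻ-injective (e-primitive j j<m)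
          (trans (•ᶻ-distribʳ (+ n (suc j)) (+ k) (e (suc j)))
            (trans (cong₂ _-ᶻ_ (sym (edge-multiple j<m)) (sym q≡))
              (trans (-ᶻ-interchange (v (suc j)) (v j) (q (suc j)) (q j)) r≡)))

    -- From a factorisation of P to a chain.

    module Factorisation (Q R : List ℤ²) (factor : ∀ x → InHull P x ⇔ InMink Q R x) where

      sum-hull : ∀ {y z} → Hull Q y → Hull R z → Hull P (y +ᵠ z)
      sum-hull Y Z = InHull⇒Hull (proj₂ (factor _) (_ , _ , Hull⇒InHull Y , Hull⇒InHull Z , refl))

      -- Replacing `y` by `y′` while keeping `z` stays inside P, so the minimum of a sum is a
      -- minimum in each part.
      minˡ : ∀ {y z d} → Hull R z → (∀ {x} → Hull P x → det (y +ᵠ z) d ≤ det x d) → ∀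
          {y′} → Hull Q y′ → det y d ≤ det y′ d
      minˡ {y} {z} {d} Z minimal {y′} Y′ = subst₂ _≤_ (cancel (det y d) (det z d)) (cancel (det y′ d) (det z d))
        (+-monoˡ-≤ (- det z d) (subst₂ _≤_ (det-add y z d) (det-add y′ z d) (minimal (sum-hull Y′ Z))))
        where
        cancel : ∀ a b → a + b - b ≡ a
        cancel = solve 2 (λ a b → a :+ b :- b := a) refl

      minʳ : ∀ {y z d} → Hull Q y → (∀ {x} → Hull P x → det (y +ᵠ z) d ≤ det x d) → ∀
          {z′} → Hull R z′ → det z d ≤ det z′ d
      minʳ {y} {z} {d} Y minimal {z′} Z′ = subst₂ _≤_ (cancel (det y d) (det z d)) (cancel (det y d) (det z′ d))
        (+-monoˡ-≤ (- det y d) (subst₂ _≤_ (det-add y z d) (det-add y z′ d) (minimal (sum-hull Y Z′))))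
        where
        cancel : ∀ a b → a + b - a ≡ b
        cancel = solve 2 (λ a b → a :+ b :- a := b) refl

      record Vertex (j : ℕ) (p : ℤ²) : Set where
        field
          p∈Q     : p ∈ Q
          r∈R     : Hull R (toℚ² (v j -ᶻ p))
          afterˡ  : ∀ {y} → Hull Q y → det (toℚ² p) (D j) ≤ det y (D j)
          beforeˡ : ∀ {y} → Hull Q y → det (toℚ² p) (D (m′ ℕ.+ j)) ≤ det y (D (m′ ℕ.+ j))
          afterʳ  : ∀ {z} → Hull R z → det (toℚ² (v j -ᶻ p)) (D j) ≤ det z (D j)
          beforeʳ : ∀ {z} → Hull R z → det (toℚ² (v j -ᶻ p)) (D (m′ ℕ.+ j)) ≤ det z (D (m′ ℕ.+ j))

      -- A vertex of P is y + z with y and z minimising the functionals of both adjacent edges, and so does a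
      -- generator p of Q; as these functionals are independent, y = p.
      module _ (j : ℕ) {y z : ℚ²} (Y : Hull Q y) (Z : Hull R z) (V≡ : V j ≡ y +ᵠ z) where

        min₂ : ∀ {x} → Hull P x → det (y +ᵠ z) (D j) ≤ det x (D j)
        min₂ {x} C = subst (λ a → det a (D j) ≤ det x (D j)) V≡ (hull-inside C j)
        -- `hull-inside` locates the minimum at the start of the preceding edge; its end, which is
        -- `V j`, has the same height over that edge.
        same : det (V (m′ ℕ.+ j)) (D (m′ ℕ.+ j)) ≡ det (y +ᵠ z) (D (m′ ℕ.+ j))
        same = begin
          det a d                ≡⟨ sym (+-identityʳ (det a d)) ⟩
          det a d + 0ℚ           ≡⟨ cong (λ s → det a d + s) (sym (det-self d)) ⟩
          det a d + det d d        ≡⟨ sym (det-add a d d) ⟩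
          det (a +ᵠ d) d         ≡⟨ cong (λ b → det b d) (+ᵠ--ᵠ a (V (suc (m′ ℕ.+ j)))) ⟩
          det (V (m ℕ.+ j)) d    ≡⟨ cong (λ b → det b d) (trans (V-periodic j) V≡) ⟩
          det (y +ᵠ z) d ∎
          where
          open ≡-Reasoning
          a = V (m′ ℕ.+ j)
          d = D (m′ ℕ.+ j)
        min₁ : ∀ {x} → Hull P x → det (y +ᵠ z) (D (m′ ℕ.+ j)) ≤ det x (D (m′ ℕ.+ j))
        min₁ {x} C = subst (_≤ det x (D (m′ ℕ.+ j))) same (hull-inside C (m′ ℕ.+ j))
        generator : ∃[ p ] (p ∈ Q × det (toℚ² p) (D (m′ ℕ.+ j)) ≡ det y (D (m′ ℕ.+ j)) × det (toℚ² p) (D j) ≡ det y (D j))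
        generator = cone-minimiser {d₁ = D (m′ ℕ.+ j)} {D j} {det y (D (m′ ℕ.+ j))} {det y (D j)} Y (positive⁻¹ 1ℚ)
          (λ q∈ → minˡ {y} {z} {D (m′ ℕ.+ j)} Z min₁ (hull-∈ q∈) , minˡ {y} {z} {D j} Z min₂ (hull-∈ q∈))
          (sym (*-identityˡ (det y (D (m′ ℕ.+ j))))) (sym (*-identityˡ (det y (D j))))

      module _ (j : ℕ) {y z : ℚ²} (Y : Hull Q y) (Z : Hull R z) (V≡ : V j ≡ y +ᵠ z) {p : ℤ²} (p∈Q : p ∈ Q)
        (before≡ : det (toℚ² p) (D (m′ ℕ.+ j)) ≡ det y (D (m′ ℕ.+ j))) (after≡ : det (toℚ² p) (D j) ≡ det y (D j)) where

        p≡y : toℚ² p ≡ y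
        p≡y = -ᵠ-zero⁻¹ {toℚ² p} {y} (det-nondegenerate {D j} {D (m′ ℕ.+ j)} {toℚ² p -ᵠ y} (subst (λ d → 0ℚ < det d
            (D (m′ ℕ.+ j))) (D-periodic j) (turn (m′ ℕ.+ j)))
          (det-difference {toℚ² p} {y} {D j} after≡) (det-difference {toℚ² p} {y} {D (m′ ℕ.+ j)} before≡))
        r≡z : toℚ² (v j -ᶻ p) ≡ z
        r≡z = trans (toℚ²-sub (v j) p) (trans (cong₂ _-ᵠ_ V≡ p≡y) (ℚ²-ext (cancel (proj₁ y) (proj₁ z)) (cancel
            (proj₂ y) (proj₂ z))))
          where
          cancel : ∀ a b → (a + b) - a ≡ b
          cancel = solve 2 (λ a b → (a :+ b) :- a := b) refl

        vertex-of : Vertex j p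
        vertex-of = record
          { p∈Q     = p∈Q
          ; r∈R     = subst (Hull R) (sym r≡z) Z
          ; afterˡ  = λ {y′} Y′ → subst (λ a → det a (D j) ≤ det y′ (D j)) (sym p≡y) (minˡ {y} {z} {D j} Z
              (min₂ j Y Z V≡) Y′)
          ; beforeˡ = λ {y′} Y′ → subst (λ a → det a (D (m′ ℕ.+ j)) ≤ det y′ (D (m′ ℕ.+ j))) (sym p≡y) (minˡ {y} {z}
              {D (m′ ℕ.+ j)} Z (min₁ j Y Z V≡) Y′)
          ; afterʳ  = λ {z′} Z′ → subst (λ a → det a (D j) ≤ det z′ (D j)) (sym r≡z) (minʳ {y} {z} {D j} Y
              (min₂ j Y Z V≡) Z′)
          ; beforeʳ = λ {z′} Z′ → subst (λ a → det a (D (m′ ℕ.+ j)) ≤ det z′ (D (m′ ℕ.+ j))) (sym r≡z) (minʳ {y} {z}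
              {D (m′ ℕ.+ j)} Y (min₁ j Y Z V≡) Z′)
          }

      abstract
        vertex : ∀ j → ∃[ p ] Vertex j p
        vertex j = let y , z , Y , Z , V≡ = proj₁ (factor (V j)) (Hull⇒InHull (hull-∈ (v∈P j))) in
          let p , p∈Q , before≡ , after≡ = generator j (InHull⇒Hull Y) (InHull⇒Hull Z) V≡ in
          p , vertex-of j (InHull⇒Hull Y) (InHull⇒Hull Z) V≡ p∈Q before≡ after≡

      q : ℕ → ℤ²
      q j = proj₁ (vertex j)

      module Vq (j : ℕ) = Vertex (proj₂ (vertex j))

      chain : SubChain q
      chain = supported-chain {Q} {R}
        (record { member = λ j → hull-∈ (Vq.p∈Q j) ; after = Vq.afterˡ ; before = Vq.beforeˡ })
        (record { member = Vq.r∈R ; after = Vq.afterʳ ; before = Vq.beforeʳ })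

      -- Every complementary point `r` lies in R, so `r + x` lies in P and splits along `q`. Thus
      -- the complementary points can be cancelled, whatever the shape of the hull of `points q`.
      Q⇒points : ∀ {x} → Hull Q x → Hull (points q) x
      Q⇒points {x} C = minkowski-cancel {points q} {points (complement q)} (λ ()) λ {r} r∈ →
        let j , _ , r≡ = ∈-points⁻ (complement q) r∈ in
        polygon-split q (subst (Hull P) (+ᵠ-comm x (toℚ² r)) (sum-hull C (subst (Hull R ∘ toℚ²) (sym r≡) (Vq.r∈R j))))

      offset : ℤ²
      offset = q 0 -ᶻ v 0

      walk : ℕ → ℤ²
      walk j = q j -ᶻ offset

      walk-0 : walk 0 ≡ v 0
      walk-0 = -ᶻ-swap {offset} {q 0} {v 0} refl

      walk-chain : SubChain walk
      walk-chain = record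
        { closed = cong (_-ᶻ offset) (SubChain.closed chain)
        ; edge   = λ j j<m → let k , k≤n , q≡ = SubChain.edge chain j j<m in
            k , k≤n , trans (-ᶻ-cancelʳ (q (suc j)) (q j) offset) q≡
        }

      walk-translate : Translate (points walk) Q
      walk-translate = toℚ² offset , λ x →
        (λ C → Hull⇒InHull (hull-translate {points q} {points walk} {x} { -t }
          (λ p∈ → let j , j≤m , p≡ = ∈-points⁻ q p∈ in
            subst (Hull (points walk)) (trans (toℚ²-sub (q j) offset) (cong (λ p → toℚ² p +ᵠ -t) (sym p≡))) (hull-∈
                (∈-points⁺ walk j≤m)))
          (Q⇒points (InHull⇒Hull C)))) ,
        (λ C → Hull⇒InHull (subst (Hull Q) (-ᵠ-+ᵠ x (toℚ² offset)) (hull-translate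
          (λ p∈ → let j , j≤m , p≡ = ∈-points⁻ walk p∈ in
            subst (Hull Q) (trans (sym (-ᵠ-+ᵠ (toℚ² (q j)) (toℚ² offset)))
              (cong (_+ᵠ toℚ² offset) (trans (sym (toℚ²-sub (q j) offset)) (cong toℚ² (sym p≡))))) (hull-∈ (Vq.p∈Q j)))
          (InHull⇒Hull C))))
        where
        -t : ℚ²
        -t = - proj₁ (toℚ² offset) , - proj₂ (toℚ² offset)

    -- Counting summands by closed walks.

    Boundary : List ℤ² → Set
    Boundary ps = ∃[ q ] (q 0 ≡ v 0 × SubChain q × ps ≡ points q)

    enumeration : ∀ L → (∀ {ps} → ps ∈ L → Boundary ps) → (∀ {ps} → Boundary ps → ps ∈ L) → Unique L →
      NumSummands P (length L)
    enumeration L sound complete unique = lookup L , summand , distinct , exhaustive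
      where
      summand : ∀ j → IsSummand P (lookup L j)
      summand j = let q , _ , Q , ps≡ = sound (∈-lookup j) in subst (IsSummand P) (sym ps≡) (chain-summand Q)

      distinct : ∀ j k → Translate (lookup L j) (lookup L k) → j ≡ k
      distinct j k T =
        let q , q0 , Q , ps≡ = sound (∈-lookup j) ; q′ , q′0 , Q′ , ps′≡ = sound (∈-lookup k) in
        lookup-injective unique j k
          (trans ps≡ (trans (translate-unique Q Q′ (trans q0 (sym q′0)) (subst₂ Translate ps≡ ps′≡ T)) (sym ps′≡)))

      exhaustive : ∀ Q → IsSummand P Q → ∃[ j ] Translate (lookup L j) Q
      exhaustive Q (_ , R , _ , factor) =
        Any.index walk∈L , subst (λ ps → Translate ps Q) (lookup-index walk∈L) walk-translate
        where
        open Factorisation Q R factor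
        walk∈L : points walk ∈ L
        walk∈L = complete (walk , walk-0 , walk-chain , refl)

    open Walks (λ w → InHull P (toℚ² w)) region? (v 0) n e public

    walk-boundary : ∀ {ps} → Walk m (v 0) ps → Boundary ps
    walk-boundary W =
      let q , q0 , qm , steps , ps≡ = walk-path W in
      q , q0 , record
        { closed = trans qm (sym q0)
        ; edge   = λ i i<m → let k , k≤n , q≡ = steps i i<m in k , k≤n , -ᶻ-swap {q i} {q (suc i)} q≡
        } , ps≡

    boundary-walk : ∀ {ps} → Boundary ps → Walk m (v 0) ps
    boundary-walk (q , q0 , Q , ps≡) = subst (Walk m (v 0)) (sym ps≡)
      (subst (λ w → Walk m w (points q)) (trans (SubChain.closed Q) q0) (path-walk q0 m
        (λ j j<m → let k , k≤n , q≡ = SubChain.edge Q j j<m in k , k≤n , -ᶻ-swap⁻¹ {q j} {q (suc j)} q≡)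
        (λ j j≤m → Hull⇒InHull (chain-in-hull Q q0 j≤m))))

open Summands
open import Data.Nat using (_≤_; _∸_)
open import Data.Integer using (+_)

theorem14 : (m : ℕ) (v : ℕ → ℤ²) → ClockwiseConvex m v →
    (n : ℕ → ℕ) (e : ℕ → ℤ²) →
    (∀ i → 1 ≤ i → i ≤ m → (n i ≡ gcd² (Edge v i)) × (Edge v i ≡ n i • e i) × (gcd² (e i) ≡ 1)) →
    (c : ℕ → ℤ² → ℤ) →
    c 0 (v 0) ≡ + 1 →
    (∀ w → InHull (Polygon m v) (toℚ² w) → w ≢ v 0 → c 0 w ≡ + 0) →
    (∀ i w → i ≤ m → ¬ InHull (Polygon m v) (toℚ² w) → c i w ≡ + 0) →
    (∀ i w → 1 ≤ i → i ≤ m → InHull (Polygon m v) (toℚ² w) →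
    c i w ≡ sumTo (n i) (λ k → c (i ∸ 1) (w -ᶻ (k • e i)))) →
    Σ ℕ (λ N → NumSummands (Polygon m v) N × (+ N ≡ c m (v 0)))
theorem14 m@(suc m′) v clockwise n e edges c c-start c-zero c-out c-step =
  length (walks m (v 0)) ,
  enumeration (walks m (v 0)) (walk-boundary ∘ walks-sound m) (walks-complete ∘ boundary-walk)
    (walks-unique m e-primitive m ℕₚ.≤-refl (v 0)) ,
  walks-length m c c-start c-zero c-out (λ i w → c-step (suc i) w (s≤s z≤n)) m ℕₚ.≤-refl (v 0)
  where open LatticePolygon m′ v clockwise n e edges
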